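{- Let $M,N\in\mathbb N$ with $M<N$. Let $$\mathsf{direct}=\lambda\_.\ \mathsf{let}\ \iota=\mathsf{tape}\,M\ \mathsf{in}\ \mathsf{rand}\,M\,\iota,$$ $$\mathsf{RS}=\lambda\_.\ \mathsf{let}\ \iota=\mathsf{tape}\,N\ \mathsf{in}\ \big(\mathsf{rec}\ rs\ \_=\ \mathsf{let}\ x=\mathsf{rand}\,N\,\iota\ \mathsf{in}\ \mathsf{if}\ x\le M\ \mathsf{then}\ x\ \mathsf{else}\ rs\,()\big)\,().$$ Then $\mathsf{direct}$ and $\mathsf{RS}$ are contextually equivalent at type $\mathsf{unit}\to\mathsf{nat}$ in the empty typing context.
   Context: **Distributions.** A (sub)distribution on a countable set $A$ is $\mu:A\to[0,1]$ with $\sum_a\mu(a)\le 1$. **Language.** A call-by-value ML-like language. Values: integers, booleans, unit $()$, heap locations $\ell$, tape labels $\iota$, recursive functions $\mathsf{rec}\,f\,x=e$ (written $\lambda x.e$ if $f$ is unused), pairs, $\mathsf{inl}\,v$, $\mathsf{inr}\,v$. Expressions: values, variables, application, arithmetic and comparison, conditionals, pairs/projections, sums/case, $\mathsf{ref}\,e$ (allocation), $!e$, $e_1\leftarrow e_2$, $\mathsf{rand}\,e$, $\mathsf{tape}\,e$, $\mathsf{rand}\,e_1\,e_2$, and the usual introduction/elimination forms for universal, existential and recursive types. A state $\sigma$ is a pair of a finite heap $Loc\rightharpoonup Val$ and a finite tape store $Lbl\rightharpoonup\{(N,\vec n):N\in\mathbb N,\ \vec n\in\{0,\dots,N\}^*\}$.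 **Semantics.** $\mathrm{step}(e,\sigma)$ is a subdistribution on configurations (expression, state); reduction is under right-to-left call-by-value evaluation contexts. All non-probabilistic constructs step deterministically as usual (fresh locations and labels are a function of the state). $\mathsf{rand}\,N$ steps to each $n\in\{0,\dots,N\}$ with probability $1/(N+1)$, leaving the state unchanged. $\mathsf{tape}\,N$ allocates a fresh label with the empty tape $(N,\epsilon)$. $\mathsf{rand}\,N\,\iota$: if tape $\iota$ is $(N,n::w)$ it deterministically returns $n$ and leaves $(N,w)$; if it is $(N,\epsilon)$, or if the tape's bound differs from $N$, it behaves as $\mathsf{rand}\,N$. Negative bounds are treated as $0$. No program construct writes values onto tapes. Stuck configurations have the zero step distribution. $\mathrm{exec}_0(e,\sigma)(v)=1$ if $e=v$ is a value and $0$ otherwise; $\mathrm{exec}_{m+1}(e,\sigma)(v)=1$ if $e=v$ is a value, $0$ if $e$ is a value other than $v$, and otherwise $\sum_{(e',\sigma')}\mathrm{step}(e,\sigma)(e',\sigma')\cdot\mathrm{exec}_m(e',\sigma')(v)$. $\mathrm{exec}(e,\sigma)(v)=\lim_n\mathrm{exec}_n(e,\sigma)(v)$. The termination probability is $\mathrm{exec}_{\Downarrow}(e,\sigma)=\sum_v\mathrm{exec}(e,\sigma)(v)$. **Typing.** Types are $\alpha,\mathsf{unit},\mathsf{bool},\mathsf{nat},\mathsf{int},\tau\times\tau,\tau+\tau,\tau\to\tau,\forall\alpha.\tau,\exists\alpha.\tau,\mu\alpha.\tau,\mathsf{ref}\,\tau,\mathsf{tape}$, with the standard ML/System-F-style typing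 rules for judgments $\Xi\mid\Gamma\vdash e:\tau$ ($\Xi$ type variables, $\Gamma$ program variables); $\mathsf{tape}\,e:\mathsf{tape}$ and $\mathsf{rand}\,e:\mathsf{nat}$, $\mathsf{rand}\,e\,e':\mathsf{nat}$ for $e:\mathsf{nat}$, $e':\mathsf{tape}$. Locations and labels are not typeable as source values. **Contextual equivalence.** A program context $\mathcal C$ is an expression with a hole; $\mathcal C:(\Xi\mid\Gamma\vdash\tau)\Rightarrow(\Xi'\mid\Gamma'\vdash\tau')$ means $\Xi'\mid\Gamma'\vdash\mathcal C[e]:\tau'$ for every $e$ with $\Xi\mid\Gamma\vdash e:\tau$. $e_1$ contextually refines $e_2$ at $\Xi\mid\Gamma\vdash\tau$ if for all $\tau'$, all $\mathcal C:(\Xi\mid\Gamma\vdash\tau)\Rightarrow(\emptyset\mid\emptyset\vdash\tau')$ and all states $\sigma$, $\mathrm{exec}_{\Downarrow}(\mathcal C[e_1],\sigma)\le\mathrm{exec}_{\Downarrow}(\mathcal C[e_2],\sigma)$. Contextual equivalence is refinement in both directions. -}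

module Defs where

open import Data.Bool.Base using (Bool; true; false; T; _∧_; _∨_; if_then_else_)
import Data.Bool.Properties as Bool
open import Data.Fin.Base using (Fin; toℕ)
  renaming (zero to fzero; suc to fsuc)
open import Data.Integer.Base as ℤ using (ℤ; +_; -[1+_])
import Data.Integer.Properties as ℤ
open import Data.List.Base using (List; []; _∷_; map; foldr; allFin)
open import Data.List.Relation.Unary.All using (All)
open import Data.List.Relation.Unary.Unique.Propositional using (Unique)
open import Data.Maybe.Base using (Maybe; just; nothing; _>>=_)
import Data.Maybe.Properties as Maybe
open import Data.Nat.Base as ℕ using (ℕ; zero; suc; _⊔_)
import Data.Nat.Properties as ℕ
open import Data.Product.Base using (Σ; Σ-syntax; ∃-syntax; _×_; _,_; proj₁)
open import Data.Rational.Base as ℚ using (ℚ; 0ℚ; 1ℚ)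
open import Data.String.Base using (String)
import Data.String.Properties as String
open import Relation.Binary.Definitions using (DecidableEquality)
open import Relation.Binary.PropositionalEquality
  using (_≡_; refl; ≡-≟-identity)
open import Relation.Nullary.Decidable using (Dec; yes; no; does; T?; dec⇒maybe)

------------------------------------------------------------------------
-- Lower reals

-- A (lower) real x is given by the set of rationals q with q < x.

Real : Set₁
Real = ℚ → Set

_≤ᴿ_ : Real → Real → Set
x ≤ᴿ y = ∀ q → x q → y q

-- For a convergent sequence a: q < lim a iff a is eventually bounded below
-- by some r > q.  (In general this is the limit inferior.)

lim : (ℕ → ℚ) → Real
lim a q = ∃[ r ] q ℚ.< r × ∃[ k ] (∀ n → k ℕ.≤ n → r ℚ.< a n)

sumℚ : List ℚ → ℚ
sumℚ = foldr ℚ._+_ 0ℚ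

-- The sum of a family of non-negative reals, as the supremum of its finite
-- partial sums: q < ∑ f iff there are finitely many distinct indices a and
-- rationals g a < f a with q < ∑ g a.

∑ : {A : Set} → (A → Real) → Real
∑ {A} f q = Σ[ as ∈ List A ] Unique as ×
            (Σ[ g ∈ (A → ℚ) ] All (λ a → f a (g a)) as × q ℚ.< sumℚ (map g as))

------------------------------------------------------------------------
-- Finitely supported subdistributions

-- A list of weighted outcomes; the mass of an outcome is the sum of the
-- weights it is listed with.

Dist : Set → Set
Dist A = List (ℚ × A)

dzero : {A : Set} → Dist A
dzero = []

dret : {A : Set} → A → Dist A
dret a = (1ℚ , a) ∷ []

dmap : {A B : Set} → (A → B) → Dist A → Dist B
dmap f = map (λ (p , a) → p , f a)

-- Uniform on {0, …, N}.

dunif : (N : ℕ) → Dist (Fin (suc N))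
dunif N = map (λ n → (+ 1) ℚ./ suc N , n) (allFin (suc N))

-- The sum over all a of μ(a) · f(a).

expect : {A : Set} → Dist A → (A → ℚ) → ℚ
expect μ f = sumℚ (map (λ (p , a) → p ℚ.* f a) μ)

------------------------------------------------------------------------
-- Finite maps

-- Association lists, in which the first entry for a key is the valid one.

lookup : {K A : Set} → DecidableEquality K → K → List (K × A) → Maybe A
lookup _≟_ k []             = nothing
lookup _≟_ k ((k′ , a) ∷ m) = if does (k ≟ k′) then just a else lookup _≟_ k m

fresh : {A : Set} → List (ℕ × A) → ℕ
fresh = foldr (λ (k , _) n → suc k ⊔ n) 0

------------------------------------------------------------------------
-- Syntax

Var Loc Lbl : Set
Var = String
Loc = ℕ
Lbl = ℕ

-- nothing is the anonymous binder _.

Binder : Set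
Binder = Maybe Var

data Lit : Set where
  int  : ℤ → Lit
  bool : Bool → Lit
  unit : Lit
  loc  : Loc → Lit
  lbl  : Lbl → Lit

data BinOp : Set where
  plus minus times le lt eq : BinOp

-- The constructs that bind no variable and evaluate all of their arguments.
-- randₜ is the two-argument rand, which reads from a tape.

data Op₁ : Set where
  fst snd inl inr ref load rand tape tapp pack fold unfold : Op₁

data Op₂ : Set where
  app pair store randₜ : Op₂
  bin : BinOp → Op₂

-- Λ is type abstraction, tapp type application; terms carry no types.

data Expr : Set where
  lit    : Lit → Expr
  var    : Var → Expr
  rec    : (f x : Binder) → Expr → Expr
  Λ      : Expr → Expr
  op₁    : Op₁ → Expr → Expr
  op₂    : Op₂ → Expr → Expr → Expr
  ite    : Expr → Expr → Expr → Expr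
  case   : Expr → (x : Binder) → Expr → (y : Binder) → Expr → Expr
  unpack : Expr → (x : Binder) → Expr → Expr

isVal : Expr → Bool
isVal (lit _)         = true
isVal (rec _ _ _)     = true
isVal (Λ _)           = true
isVal (op₁ inl e)     = isVal e
isVal (op₁ inr e)     = isVal e
isVal (op₁ pack e)    = isVal e
isVal (op₁ fold e)    = isVal e
isVal (op₂ pair e e′) = isVal e ∧ isVal e′
isVal _               = false

Val : Set
Val = Σ[ e ∈ Expr ] T (isVal e)

val? : (e : Expr) → Dec (T (isVal e))
val? e = T? (isVal e)

lam : Binder → Expr → Expr
lam = rec nothing

let′ : Binder → Expr → Expr → Expr
let′ x e₁ e₂ = op₂ app (lam x e₂) e₁

natLit : ℕ → Expr
natLit n = lit (int (+ n))

------------------------------------------------------------------------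
-- Decidable equality of expressions

-- It suffices to give a test for equality that succeeds on the diagonal.

private
  diagonal⇒dec : {A : Set} (same : (a b : A) → Maybe (a ≡ b)) →
                 (∀ a → same a a ≡ just refl) → DecidableEquality A
  diagonal⇒dec same diag a b with same a b in p
  ... | just a≡b = yes a≡b
  ... | nothing  = no λ { refl → absurd p (diag a) }
    where
    absurd : ∀ {B C : Set} {m : Maybe B} {b : B} → m ≡ nothing → m ≡ just b → C
    absurd refl ()

  sameBinOp : (o o′ : BinOp) → Maybe (o ≡ o′)
  sameBinOp plus  plus  = just refl
  sameBinOp minus minus = just refl
  sameBinOp times times = just refl
  sameBinOp le    le    = just refl
  sameBinOp lt    lt    = just refl
  sameBinOp eq    eq    = just refl
  sameBinOp _     _     = nothing

  sameBinOp-diag : ∀ o → sameBinOp o o ≡ just refl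
  sameBinOp-diag plus  = refl
  sameBinOp-diag minus = refl
  sameBinOp-diag times = refl
  sameBinOp-diag le    = refl
  sameBinOp-diag lt    = refl
  sameBinOp-diag eq    = refl

  sameOp₁ : (o o′ : Op₁) → Maybe (o ≡ o′)
  sameOp₁ fst    fst    = just refl
  sameOp₁ snd    snd    = just refl
  sameOp₁ inl    inl    = just refl
  sameOp₁ inr    inr    = just refl
  sameOp₁ ref    ref    = just refl
  sameOp₁ load   load   = just refl
  sameOp₁ rand   rand   = just refl
  sameOp₁ tape   tape   = just refl
  sameOp₁ tapp   tapp   = just refl
  sameOp₁ pack   pack   = just refl
  sameOp₁ fold   fold   = just refl
  sameOp₁ unfold unfold = just refl
  sameOp₁ _      _      = nothing

  sameOp₁-diag : ∀ o → sameOp₁ o o ≡ just refl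
  sameOp₁-diag fst    = refl
  sameOp₁-diag snd    = refl
  sameOp₁-diag inl    = refl
  sameOp₁-diag inr    = refl
  sameOp₁-diag ref    = refl
  sameOp₁-diag load   = refl
  sameOp₁-diag rand   = refl
  sameOp₁-diag tape   = refl
  sameOp₁-diag tapp   = refl
  sameOp₁-diag pack   = refl
  sameOp₁-diag fold   = refl
  sameOp₁-diag unfold = refl

  sameOp₂ : (o o′ : Op₂) → Maybe (o ≡ o′)
  sameOp₂ app     app      = just refl
  sameOp₂ pair    pair     = just refl
  sameOp₂ store   store    = just refl
  sameOp₂ randₜ   randₜ    = just refl
  sameOp₂ (bin o) (bin o′) = sameBinOp o o′ >>= λ { refl → just refl }
  sameOp₂ _       _        = nothing

  sameOp₂-diag : ∀ o → sameOp₂ o o ≡ just refl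
  sameOp₂-diag app     = refl
  sameOp₂-diag pair    = refl
  sameOp₂-diag store   = refl
  sameOp₂-diag randₜ   = refl
  sameOp₂-diag (bin o) rewrite sameBinOp-diag o = refl

  sameLit : (l l′ : Lit) → Maybe (l ≡ l′)
  sameLit (int i)  (int j)  = dec⇒maybe (i ℤ.≟ j) >>= λ { refl → just refl }
  sameLit (bool b) (bool c) = dec⇒maybe (b Bool.≟ c) >>= λ { refl → just refl }
  sameLit unit     unit     = just refl
  sameLit (loc k)  (loc l)  = dec⇒maybe (k ℕ.≟ l) >>= λ { refl → just refl }
  sameLit (lbl k)  (lbl l)  = dec⇒maybe (k ℕ.≟ l) >>= λ { refl → just refl }
  sameLit _        _        = nothing

  sameLit-diag : ∀ l → sameLit l l ≡ just refl
  sameLit-diag (int i)  rewrite ≡-≟-identity ℤ._≟_ {i} refl = refl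
  sameLit-diag (bool b) rewrite ≡-≟-identity Bool._≟_ {b} refl = refl
  sameLit-diag unit     = refl
  sameLit-diag (loc k)  rewrite ≡-≟-identity ℕ._≟_ {k} refl = refl
  sameLit-diag (lbl k)  rewrite ≡-≟-identity ℕ._≟_ {k} refl = refl

_≟ᴮ_ : DecidableEquality Binder
_≟ᴮ_ = Maybe.≡-dec String._≟_

_≟ᴸ_ : DecidableEquality Lit
_≟ᴸ_ = diagonal⇒dec sameLit sameLit-diag

private
  same : (e e′ : Expr) → Maybe (e ≡ e′)
  same (lit l) (lit l′) =
    sameLit l l′ >>= λ { refl → just refl }
  same (var x) (var x′) =
    dec⇒maybe (x String.≟ x′) >>= λ { refl → just refl }
  same (rec f x e) (rec f′ x′ e′) =
    dec⇒maybe (f ≟ᴮ f′) >>= λ { refl →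
    dec⇒maybe (x ≟ᴮ x′) >>= λ { refl →
    same e e′ >>= λ { refl → just refl }}}
  same (Λ e) (Λ e′) =
    same e e′ >>= λ { refl → just refl }
  same (op₁ o e) (op₁ o′ e′) =
    sameOp₁ o o′ >>= λ { refl →
    same e e′ >>= λ { refl → just refl }}
  same (op₂ o d e) (op₂ o′ d′ e′) =
    sameOp₂ o o′ >>= λ { refl →
    same d d′ >>= λ { refl →
    same e e′ >>= λ { refl → just refl }}}
  same (ite c d e) (ite c′ d′ e′) =
    same c c′ >>= λ { refl →
    same d d′ >>= λ { refl →
    same e e′ >>= λ { refl → just refl }}}
  same (case c x d y e) (case c′ x′ d′ y′ e′) =
    same c c′ >>= λ { refl →
    dec⇒maybe (x ≟ᴮ x′) >>= λ { refl →
    same d d′ >>= λ { refl →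
    dec⇒maybe (y ≟ᴮ y′) >>= λ { refl →
    same e e′ >>= λ { refl → just refl }}}}}
  same (unpack d x e) (unpack d′ x′ e′) =
    same d d′ >>= λ { refl →
    dec⇒maybe (x ≟ᴮ x′) >>= λ { refl →
    same e e′ >>= λ { refl → just refl }}}
  same _ _ = nothing

  same-diag : ∀ e → same e e ≡ just refl
  same-diag (lit l) rewrite sameLit-diag l = refl
  same-diag (var x) rewrite ≡-≟-identity String._≟_ {x} refl = refl
  same-diag (rec f x e)
    rewrite ≡-≟-identity _≟ᴮ_ {f} refl | ≡-≟-identity _≟ᴮ_ {x} refl | same-diag e = refl
  same-diag (Λ e) rewrite same-diag e = refl
  same-diag (op₁ o e) rewrite sameOp₁-diag o | same-diag e = refl
  same-diag (op₂ o d e)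
    rewrite sameOp₂-diag o | same-diag d | same-diag e = refl
  same-diag (ite c d e)
    rewrite same-diag c | same-diag d | same-diag e = refl
  same-diag (case c x d y e)
    rewrite same-diag c | ≡-≟-identity _≟ᴮ_ {x} refl | same-diag d
          | ≡-≟-identity _≟ᴮ_ {y} refl | same-diag e = refl
  same-diag (unpack d x e)
    rewrite same-diag d | ≡-≟-identity _≟ᴮ_ {x} refl | same-diag e = refl

_≟ᴱ_ : DecidableEquality Expr
_≟ᴱ_ = diagonal⇒dec same same-diag

------------------------------------------------------------------------
-- Substitution

binds : Binder → Var → Bool
binds nothing  x = false
binds (just y) x = does (x String.≟ y)

-- Only ever used with a closed v, so that no variable can be captured.

substᵉ : Var → Expr → Expr → Expr
substᵉ x v (lit l)          = lit l
substᵉ x v (var y)          = if does (x String.≟ y) then v else var y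
substᵉ x v (rec f y e)      =
  rec f y (if binds f x ∨ binds y x then e else substᵉ x v e)
substᵉ x v (Λ e)            = Λ (substᵉ x v e)
substᵉ x v (op₁ o e)        = op₁ o (substᵉ x v e)
substᵉ x v (op₂ o d e)      = op₂ o (substᵉ x v d) (substᵉ x v e)
substᵉ x v (ite c d e)      = ite (substᵉ x v c) (substᵉ x v d) (substᵉ x v e)
substᵉ x v (case c y d z e) =
  case (substᵉ x v c) y (if binds y x then d else substᵉ x v d)
                     z (if binds z x then e else substᵉ x v e)
substᵉ x v (unpack d y e)   =
  unpack (substᵉ x v d) y (if binds y x then e else substᵉ x v e)

substᴮ : Binder → Expr → Expr → Expr
substᴮ nothing  v e = e
substᴮ (just x) v e = substᵉ x v e

------------------------------------------------------------------------
-- Semantics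

-- A tape (N , ns) has bound N and contents ns ∈ {0, …, N}*.

Tape : Set
Tape = Σ[ N ∈ ℕ ] List (Fin (suc N))

record State : Set where
  constructor ⟨_,_⟩
  field
    heap  : List (Loc × Val)
    tapes : List (Lbl × Tape)

open State public

Cfg : Set
Cfg = Expr × State

putHeap : Loc → Val → State → State
putHeap ℓ v ⟨ h , t ⟩ = ⟨ (ℓ , v) ∷ h , t ⟩

putTape : Lbl → Tape → State → State
putTape ι t ⟨ h , ts ⟩ = ⟨ h , (ι , t) ∷ ts ⟩

-- Negative bounds are treated as 0.

toBound : ℤ → ℕ
toBound (+ n)    = n
toBound -[1+ _ ] = 0

-- Stuck (nothing) on ill-typed operands.

evalBin : BinOp → Lit → Lit → Maybe Lit
evalBin plus  (int i) (int j) = just (int (i ℤ.+ j))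
evalBin minus (int i) (int j) = just (int (i ℤ.- j))
evalBin times (int i) (int j) = just (int (i ℤ.* j))
evalBin le    (int i) (int j) = just (bool (does (i ℤ.≤? j)))
evalBin lt    (int i) (int j) = just (bool (does (i ℤ.<? j)))
evalBin eq    l       l′      = just (bool (does (l ≟ᴸ l′)))
evalBin _     _       _       = nothing

uniform : ℕ → State → Dist Cfg
uniform N σ = dmap (λ n → natLit (toℕ n) , σ) (dunif N)

randTape : ℕ → Lbl → Tape → State → Dist Cfg
randTape N ι (N′ , [])    σ = uniform N σ
randTape N ι (N′ , n ∷ w) σ =
  if does (N′ ℕ.≟ N) then dret (natLit (toℕ n) , putTape ι (N′ , w) σ)
                     else uniform N σ

-- The steps of a redex, that is, of an expression whose evaluated arguments
-- are values; evaluation contexts are dealt with by step.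

headStep : Expr → State → Dist Cfg
headStep (op₂ app (rec f x e) v)                   σ =
  dret (substᴮ f (rec f x e) (substᴮ x v e) , σ)
headStep (op₂ (bin o) (lit l) (lit l′))            σ with evalBin o l l′
... | just l″ = dret (lit l″ , σ)
... | nothing = dzero
headStep (ite (lit (bool b)) e₁ e₂)                σ =
  dret ((if b then e₁ else e₂) , σ)
headStep (op₁ fst (op₂ pair v w))                  σ = dret (v , σ)
headStep (op₁ snd (op₂ pair v w))                  σ = dret (w , σ)
headStep (case (op₁ inl v) x e₁ y e₂)              σ = dret (substᴮ x v e₁ , σ)
headStep (case (op₁ inr v) x e₁ y e₂)              σ = dret (substᴮ y v e₂ , σ)
headStep (op₁ tapp (Λ e))                          σ = dret (e , σ)
headStep (unpack (op₁ pack v) x e)                 σ = dret (substᴮ x v e , σ)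
headStep (op₁ unfold (op₁ fold v))                 σ = dret (v , σ)
headStep (op₁ ref e)                               σ with val? e
... | yes v = let ℓ = fresh (heap σ) in dret (lit (loc ℓ) , putHeap ℓ (e , v) σ)
... | no _  = dzero
headStep (op₁ load (lit (loc ℓ)))                  σ with lookup ℕ._≟_ ℓ (heap σ)
... | just (e , _) = dret (e , σ)
... | nothing      = dzero
headStep (op₂ store (lit (loc ℓ)) e)               σ with lookup ℕ._≟_ ℓ (heap σ) | val? e
... | just _ | yes v = dret (lit unit , putHeap ℓ (e , v) σ)
... | _      | _     = dzero
headStep (op₁ rand (lit (int z)))                  σ = uniform (toBound z) σ
headStep (op₁ tape (lit (int z)))                  σ =
  let ι = fresh (tapes σ) in dret (lit (lbl ι) , putTape ι (toBound z , []) σ)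
headStep (op₂ randₜ (lit (int z)) (lit (lbl ι)))   σ with lookup ℕ._≟_ ι (tapes σ)
... | just t  = randTape (toBound z) ι t σ
... | nothing = dzero
headStep _                                         σ = dzero

-- Evaluation contexts, as lists of frames with the outermost frame first.
-- Arguments are evaluated from right to left.

data Frame : Set where
  op₁F    : Op₁ → Frame
  op₂Fʳ   : Op₂ → Expr → Frame
  op₂Fˡ   : Op₂ → Val → Frame
  iteF    : Expr → Expr → Frame
  caseF   : Binder → Expr → Binder → Expr → Frame
  unpackF : Binder → Expr → Frame

fillF : Frame → Expr → Expr
fillF (op₁F o)          d = op₁ o d
fillF (op₂Fʳ o e)       d = op₂ o e d
fillF (op₂Fˡ o (v , _)) d = op₂ o d v
fillF (iteF e₁ e₂)      d = ite d e₁ e₂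
fillF (caseF x e₁ y e₂) d = case d x e₁ y e₂
fillF (unpackF x e)     d = unpack d x e

fill : List Frame → Expr → Expr
fill K e = foldr fillF e K

-- decomp e = (K , r) with fill K r = e, where r is e itself if no argument
-- of e remains to be evaluated.

decomp : Expr → List Frame × Expr

within : Frame → Expr → List Frame × Expr
within F e = let (K , r) = decomp e in F ∷ K , r

decomp (op₁ o e) with val? e
... | yes _ = [] , op₁ o e
... | no _  = within (op₁F o) e
decomp (op₂ o d e) with val? d | val? e
... | _     | no _  = within (op₂Fʳ o d) e
... | no _  | yes v = within (op₂Fˡ o (e , v)) d
... | yes _ | yes _ = [] , op₂ o d e
decomp (ite c e₁ e₂) with val? c
... | yes _ = [] , ite c e₁ e₂
... | no _  = within (iteF e₁ e₂) c
decomp (case c x e₁ y e₂) with val? c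
... | yes _ = [] , case c x e₁ y e₂
... | no _  = within (caseF x e₁ y e₂) c
decomp (unpack d x e) with val? d
... | yes _ = [] , unpack d x e
... | no _  = within (unpackF x e) d
decomp e = [] , e

step : Cfg → Dist Cfg
step (e , σ) = let (K , r) = decomp e in
  dmap (λ (e′ , σ′) → fill K e′ , σ′) (headStep r σ)

indicator : Expr → Val → ℚ
indicator e (v , _) = if does (e ≟ᴱ v) then 1ℚ else 0ℚ

execₙ : ℕ → Cfg → Val → ℚ
execₙ zero    (e , σ) v = indicator e v
execₙ (suc m) (e , σ) v =
  if isVal e then indicator e v
             else expect (step (e , σ)) (λ ρ → execₙ m ρ v)

exec : Cfg → Val → Real
exec ρ v = lim (λ n → execₙ n ρ v)

exec⇓ : Cfg → Real
exec⇓ ρ = ∑ (exec ρ)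

------------------------------------------------------------------------
-- Types

infixr 6 _⇒_
infixr 7 _⊕_
infixr 8 _⊗_

-- Types with type variables among Ξ, as de Bruijn indices.

data Type (Ξ : ℕ) : Set where
  tvar                          : Fin Ξ → Type Ξ
  unitᵗ boolᵗ natᵗ intᵗ tapeᵗ   : Type Ξ
  _⊗_ _⊕_ _⇒_                   : Type Ξ → Type Ξ → Type Ξ
  ∀ᵗ ∃ᵗ μᵗ                      : Type (suc Ξ) → Type Ξ
  refᵗ                          : Type Ξ → Type Ξ

private variable
  Ξ Ξ′ : ℕ

extᵗ : (Fin Ξ → Fin Ξ′) → Fin (suc Ξ) → Fin (suc Ξ′)
extᵗ ρ fzero    = fzero
extᵗ ρ (fsuc i) = fsuc (ρ i)

renameᵗ : (Fin Ξ → Fin Ξ′) → Type Ξ → Type Ξ′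
renameᵗ ρ (tvar i) = tvar (ρ i)
renameᵗ ρ unitᵗ    = unitᵗ
renameᵗ ρ boolᵗ    = boolᵗ
renameᵗ ρ natᵗ     = natᵗ
renameᵗ ρ intᵗ     = intᵗ
renameᵗ ρ tapeᵗ    = tapeᵗ
renameᵗ ρ (τ ⊗ τ′) = renameᵗ ρ τ ⊗ renameᵗ ρ τ′
renameᵗ ρ (τ ⊕ τ′) = renameᵗ ρ τ ⊕ renameᵗ ρ τ′
renameᵗ ρ (τ ⇒ τ′) = renameᵗ ρ τ ⇒ renameᵗ ρ τ′
renameᵗ ρ (∀ᵗ τ)   = ∀ᵗ (renameᵗ (extᵗ ρ) τ)
renameᵗ ρ (∃ᵗ τ)   = ∃ᵗ (renameᵗ (extᵗ ρ) τ)
renameᵗ ρ (μᵗ τ)   = μᵗ (renameᵗ (extᵗ ρ) τ)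
renameᵗ ρ (refᵗ τ) = refᵗ (renameᵗ ρ τ)

weakenᵗ : Type Ξ → Type (suc Ξ)
weakenᵗ = renameᵗ fsuc

extsᵗ : (Fin Ξ → Type Ξ′) → Fin (suc Ξ) → Type (suc Ξ′)
extsᵗ s fzero    = tvar fzero
extsᵗ s (fsuc i) = weakenᵗ (s i)

substᵗ : (Fin Ξ → Type Ξ′) → Type Ξ → Type Ξ′
substᵗ s (tvar i) = s i
substᵗ s unitᵗ    = unitᵗ
substᵗ s boolᵗ    = boolᵗ
substᵗ s natᵗ     = natᵗ
substᵗ s intᵗ     = intᵗ
substᵗ s tapeᵗ    = tapeᵗ
substᵗ s (τ ⊗ τ′) = substᵗ s τ ⊗ substᵗ s τ′
substᵗ s (τ ⊕ τ′) = substᵗ s τ ⊕ substᵗ s τ′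
substᵗ s (τ ⇒ τ′) = substᵗ s τ ⇒ substᵗ s τ′
substᵗ s (∀ᵗ τ)   = ∀ᵗ (substᵗ (extsᵗ s) τ)
substᵗ s (∃ᵗ τ)   = ∃ᵗ (substᵗ (extsᵗ s) τ)
substᵗ s (μᵗ τ)   = μᵗ (substᵗ (extsᵗ s) τ)
substᵗ s (refᵗ τ) = refᵗ (substᵗ s τ)

_[_]ᵗ : Type (suc Ξ) → Type Ξ → Type Ξ
τ [ τ′ ]ᵗ = substᵗ (λ { fzero → τ′ ; (fsuc i) → tvar i }) τ

------------------------------------------------------------------------
-- Typing

TyEnv : ℕ → Set
TyEnv Ξ = List (Var × Type Ξ)

weakenᴱ : TyEnv Ξ → TyEnv (suc Ξ)
weakenᴱ = map (λ (x , τ) → x , weakenᵗ τ)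

_,_⦂_ : TyEnv Ξ → Binder → Type Ξ → TyEnv Ξ
Γ , nothing ⦂ τ = Γ
Γ , just x  ⦂ τ = (x , τ) ∷ Γ

-- The types at which equality may be tested.

data EqType {Ξ : ℕ} : Type Ξ → Set where
  unitᵉ : EqType unitᵗ
  boolᵉ : EqType boolᵗ
  natᵉ  : EqType natᵗ
  intᵉ  : EqType intᵗ
  refᵉ  : ∀ {τ} → EqType (refᵗ τ)

data BinOpTy {Ξ : ℕ} : BinOp → Type Ξ → Type Ξ → Set where
  plusⁿ  : BinOpTy plus natᵗ natᵗ
  timesⁿ : BinOpTy times natᵗ natᵗ
  leⁿ    : BinOpTy le natᵗ boolᵗ
  ltⁿ    : BinOpTy lt natᵗ boolᵗ
  plusⁱ  : BinOpTy plus intᵗ intᵗ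
  minusⁱ : BinOpTy minus intᵗ intᵗ
  timesⁱ : BinOpTy times intᵗ intᵗ
  leⁱ    : BinOpTy le intᵗ boolᵗ
  ltⁱ    : BinOpTy lt intᵗ boolᵗ
  eqᵉ    : ∀ {τ} → EqType τ → BinOpTy eq τ boolᵗ

infix 4 _∣_⊢_⦂_
infixl 5 _,_⦂_

data _∣_⊢_⦂_ (Ξ : ℕ) (Γ : TyEnv Ξ) : Expr → Type Ξ → Set where

  ⊢var : ∀ {x τ} → lookup String._≟_ x Γ ≡ just τ → Ξ ∣ Γ ⊢ var x ⦂ τ

  ⊢unit : Ξ ∣ Γ ⊢ lit unit ⦂ unitᵗ

  ⊢bool : ∀ {b} → Ξ ∣ Γ ⊢ lit (bool b) ⦂ boolᵗ

  ⊢nat : ∀ {n} → Ξ ∣ Γ ⊢ natLit n ⦂ natᵗ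

  ⊢int : ∀ {z} → Ξ ∣ Γ ⊢ lit (int z) ⦂ intᵗ

  ⊢nat≤int : ∀ {e} → Ξ ∣ Γ ⊢ e ⦂ natᵗ → Ξ ∣ Γ ⊢ e ⦂ intᵗ

  ⊢bin : ∀ {o e₁ e₂ τ τ′} → BinOpTy o τ τ′ →
         Ξ ∣ Γ ⊢ e₁ ⦂ τ → Ξ ∣ Γ ⊢ e₂ ⦂ τ → Ξ ∣ Γ ⊢ op₂ (bin o) e₁ e₂ ⦂ τ′

  ⊢ite : ∀ {e e₁ e₂ τ} →
         Ξ ∣ Γ ⊢ e ⦂ boolᵗ → Ξ ∣ Γ ⊢ e₁ ⦂ τ → Ξ ∣ Γ ⊢ e₂ ⦂ τ →
         Ξ ∣ Γ ⊢ ite e e₁ e₂ ⦂ τ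

  -- If f and x coincide, then x shadows f, as it does in headStep.
  ⊢rec : ∀ {f x e τ τ′} →
         Ξ ∣ Γ , f ⦂ τ ⇒ τ′ , x ⦂ τ ⊢ e ⦂ τ′ → Ξ ∣ Γ ⊢ rec f x e ⦂ τ ⇒ τ′

  ⊢app : ∀ {e₁ e₂ τ τ′} →
         Ξ ∣ Γ ⊢ e₁ ⦂ τ ⇒ τ′ → Ξ ∣ Γ ⊢ e₂ ⦂ τ → Ξ ∣ Γ ⊢ op₂ app e₁ e₂ ⦂ τ′

  ⊢pair : ∀ {e₁ e₂ τ₁ τ₂} →
          Ξ ∣ Γ ⊢ e₁ ⦂ τ₁ → Ξ ∣ Γ ⊢ e₂ ⦂ τ₂ → Ξ ∣ Γ ⊢ op₂ pair e₁ e₂ ⦂ τ₁ ⊗ τ₂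

  ⊢fst : ∀ {e τ₁ τ₂} → Ξ ∣ Γ ⊢ e ⦂ τ₁ ⊗ τ₂ → Ξ ∣ Γ ⊢ op₁ fst e ⦂ τ₁

  ⊢snd : ∀ {e τ₁ τ₂} → Ξ ∣ Γ ⊢ e ⦂ τ₁ ⊗ τ₂ → Ξ ∣ Γ ⊢ op₁ snd e ⦂ τ₂

  ⊢inl : ∀ {e τ₁ τ₂} → Ξ ∣ Γ ⊢ e ⦂ τ₁ → Ξ ∣ Γ ⊢ op₁ inl e ⦂ τ₁ ⊕ τ₂

  ⊢inr : ∀ {e τ₁ τ₂} → Ξ ∣ Γ ⊢ e ⦂ τ₂ → Ξ ∣ Γ ⊢ op₁ inr e ⦂ τ₁ ⊕ τ₂

  ⊢case : ∀ {e x e₁ y e₂ τ₁ τ₂ τ} →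
          Ξ ∣ Γ ⊢ e ⦂ τ₁ ⊕ τ₂ →
          Ξ ∣ Γ , x ⦂ τ₁ ⊢ e₁ ⦂ τ → Ξ ∣ Γ , y ⦂ τ₂ ⊢ e₂ ⦂ τ →
          Ξ ∣ Γ ⊢ case e x e₁ y e₂ ⦂ τ

  ⊢Λ : ∀ {e τ} → suc Ξ ∣ weakenᴱ Γ ⊢ e ⦂ τ → Ξ ∣ Γ ⊢ Λ e ⦂ ∀ᵗ τ

  ⊢tapp : ∀ {e τ} τ′ → Ξ ∣ Γ ⊢ e ⦂ ∀ᵗ τ → Ξ ∣ Γ ⊢ op₁ tapp e ⦂ τ [ τ′ ]ᵗ

  ⊢pack : ∀ {e τ} τ′ → Ξ ∣ Γ ⊢ e ⦂ τ [ τ′ ]ᵗ → Ξ ∣ Γ ⊢ op₁ pack e ⦂ ∃ᵗ τ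

  ⊢unpack : ∀ {e₁ x e₂ τ τ′} →
            Ξ ∣ Γ ⊢ e₁ ⦂ ∃ᵗ τ → suc Ξ ∣ weakenᴱ Γ , x ⦂ τ ⊢ e₂ ⦂ weakenᵗ τ′ →
            Ξ ∣ Γ ⊢ unpack e₁ x e₂ ⦂ τ′

  ⊢fold : ∀ {e τ} → Ξ ∣ Γ ⊢ e ⦂ τ [ μᵗ τ ]ᵗ → Ξ ∣ Γ ⊢ op₁ fold e ⦂ μᵗ τ

  ⊢unfold : ∀ {e τ} → Ξ ∣ Γ ⊢ e ⦂ μᵗ τ → Ξ ∣ Γ ⊢ op₁ unfold e ⦂ τ [ μᵗ τ ]ᵗ

  ⊢ref : ∀ {e τ} → Ξ ∣ Γ ⊢ e ⦂ τ → Ξ ∣ Γ ⊢ op₁ ref e ⦂ refᵗ τ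

  ⊢load : ∀ {e τ} → Ξ ∣ Γ ⊢ e ⦂ refᵗ τ → Ξ ∣ Γ ⊢ op₁ load e ⦂ τ

  ⊢store : ∀ {e₁ e₂ τ} →
           Ξ ∣ Γ ⊢ e₁ ⦂ refᵗ τ → Ξ ∣ Γ ⊢ e₂ ⦂ τ → Ξ ∣ Γ ⊢ op₂ store e₁ e₂ ⦂ unitᵗ

  ⊢tape : ∀ {e} → Ξ ∣ Γ ⊢ e ⦂ natᵗ → Ξ ∣ Γ ⊢ op₁ tape e ⦂ tapeᵗ

  ⊢rand : ∀ {e} → Ξ ∣ Γ ⊢ e ⦂ natᵗ → Ξ ∣ Γ ⊢ op₁ rand e ⦂ natᵗ

  ⊢randₜ : ∀ {e₁ e₂} →
           Ξ ∣ Γ ⊢ e₁ ⦂ natᵗ → Ξ ∣ Γ ⊢ e₂ ⦂ tapeᵗ → Ξ ∣ Γ ⊢ op₂ randₜ e₁ e₂ ⦂ natᵗ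

------------------------------------------------------------------------
-- Contextual refinement and equivalence

-- Expressions with one hole, which may be below binders.

data Ctx : Set where
  hole                : Ctx
  recC                : (f x : Binder) → Ctx → Ctx
  ΛC                  : Ctx → Ctx
  op₁C                : Op₁ → Ctx → Ctx
  op₂Cˡ               : Op₂ → Ctx → Expr → Ctx
  op₂Cʳ               : Op₂ → Expr → Ctx → Ctx
  iteC₁               : Ctx → Expr → Expr → Ctx
  iteC₂               : Expr → Ctx → Expr → Ctx
  iteC₃               : Expr → Expr → Ctx → Ctx
  caseC₁              : Ctx → Binder → Expr → Binder → Expr → Ctx
  caseC₂              : Expr → Binder → Ctx → Binder → Expr → Ctx
  caseC₃              : Expr → Binder → Expr → Binder → Ctx → Ctx
  unpackC₁            : Ctx → Binder → Expr → Ctx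
  unpackC₂            : Expr → Binder → Ctx → Ctx

_⟦_⟧ : Ctx → Expr → Expr
hole ⟦ d ⟧              = d
recC f x C ⟦ d ⟧        = rec f x (C ⟦ d ⟧)
ΛC C ⟦ d ⟧              = Λ (C ⟦ d ⟧)
op₁C o C ⟦ d ⟧          = op₁ o (C ⟦ d ⟧)
op₂Cˡ o C e ⟦ d ⟧       = op₂ o (C ⟦ d ⟧) e
op₂Cʳ o e C ⟦ d ⟧       = op₂ o e (C ⟦ d ⟧)
iteC₁ C e₂ e₃ ⟦ d ⟧     = ite (C ⟦ d ⟧) e₂ e₃
iteC₂ e₁ C e₃ ⟦ d ⟧     = ite e₁ (C ⟦ d ⟧) e₃
iteC₃ e₁ e₂ C ⟦ d ⟧     = ite e₁ e₂ (C ⟦ d ⟧)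
caseC₁ C x e₁ y e₂ ⟦ d ⟧ = case (C ⟦ d ⟧) x e₁ y e₂
caseC₂ e x C y e₂ ⟦ d ⟧  = case e x (C ⟦ d ⟧) y e₂
caseC₃ e x e₁ y C ⟦ d ⟧  = case e x e₁ y (C ⟦ d ⟧)
unpackC₁ C x e ⟦ d ⟧    = unpack (C ⟦ d ⟧) x e
unpackC₂ e x C ⟦ d ⟧    = unpack e x (C ⟦ d ⟧)

CtxTyped : Ctx → (Ξ : ℕ) → TyEnv Ξ → Type Ξ → (Ξ′ : ℕ) → TyEnv Ξ′ → Type Ξ′ → Set
CtxTyped C Ξ Γ τ Ξ′ Γ′ τ′ = ∀ e → Ξ ∣ Γ ⊢ e ⦂ τ → Ξ′ ∣ Γ′ ⊢ C ⟦ e ⟧ ⦂ τ′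

CtxRefines : (Ξ : ℕ) → TyEnv Ξ → Expr → Expr → Type Ξ → Set
CtxRefines Ξ Γ e₁ e₂ τ =
  (τ′ : Type 0) (C : Ctx) → CtxTyped C Ξ Γ τ 0 [] τ′ →
  (σ : State) → exec⇓ (C ⟦ e₁ ⟧ , σ) ≤ᴿ exec⇓ (C ⟦ e₂ ⟧ , σ)

CtxEquiv : (Ξ : ℕ) → TyEnv Ξ → Expr → Expr → Type Ξ → Set
CtxEquiv Ξ Γ e₁ e₂ τ = CtxRefines Ξ Γ e₁ e₂ τ × CtxRefines Ξ Γ e₂ e₁ τ

------------------------------------------------------------------------
-- The two samplers

direct : ℕ → Expr
direct M =
  lam nothing
    (let′ (just "ι") (op₁ tape (natLit M))
      (op₂ randₜ (natLit M) (var "ι")))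

RS : ℕ → ℕ → Expr
RS M N =
  lam nothing
    (let′ (just "ι") (op₁ tape (natLit N))
      (op₂ app
        (rec (just "rs") nothing
          (let′ (just "x") (op₂ randₜ (natLit N) (var "ι"))
            (ite (op₂ (bin le) (var "x") (natLit M))
              (var "x")
              (op₂ app (var "rs") (lit unit)))))
        (lit unit)))

{-# OPTIONS --safe #-}

-- The relation ~ between programs and states that replaces copies of one
-- sampler by the other, and ignores the bounds of empty tapes, is preserved by
-- every step except a call of a sampler, so that it is enough to compare the two
-- calls.  After its call, direct continues with a uniform sample from {0, …, M}.
-- With L the termination probability of the loop of RS, A the average over those
-- continuations and p = (M+1)/(N+1), one iteration gives L = p A + (1 - p) L.  At
-- a finite number of steps this yields both L ≤ A and, for every ε > 0, A ≤ L + ε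
-- after enough iterations: as long as L < A - ε, an iteration increases L by at
-- least p ε.

module Submission where

open import Defs
open import Algebra.Bundles using (CommutativeRing)
open import Data.Bool.Base using (Bool; true; false; T; if_then_else_; _∧_; _∨_)
open import Data.Bool.Properties using (T-irrelevant; T-≡; ∧-zeroʳ)
open import Data.Fin.Base using (Fin; toℕ)
open import Data.Integer.Base as ℤ using (+≤+)
import Data.Integer.Properties as ℤ
import Data.Integer.Solver as ℤ
open import Data.List.Base using ([])
open import Data.List.Base using (List; _∷_; _++_; map; length; tabulate; deduplicate)
open import Data.List.Membership.Propositional using (_∈_)
open import Data.List.Membership.Propositional.Properties using (∈-++⁺ˡ; ∈-++⁺ʳ; ∈-deduplicate⁺)
open import Data.List.Relation.Binary.Pointwise as Pointwise using (Pointwise; []; _∷_)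
open import Data.List.Relation.Unary.All as All using (All; []; _∷_)
import Data.List.Relation.Unary.All.Properties as All
open import Data.List.Relation.Unary.AllPairs using ([]; _∷_)
open import Data.List.Relation.Unary.Any using (here; there)
open import Data.List.Relation.Unary.Unique.Propositional using (Unique)
import Data.List.Relation.Unary.Unique.DecPropositional.Properties as Unique
open import Data.Maybe.Base using (just; nothing)
open import Data.Maybe.Relation.Binary.Pointwise as Maybe using (just; nothing)
open import Data.Nat.Base using (ℕ; _<_)
open import Data.Nat.Base as ℕ using (zero; suc; _⊔_)
import Data.Nat.Properties as ℕ
open import Data.Product.Base using (_×_; _,_; proj₁; proj₂; ∃-syntax)
open import Data.Rational.Base as ℚ using (ℚ; 0ℚ; 1ℚ; _+_; _*_; _-_; -_; _≤_; fromℚᵘ)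
import Data.Rational.Properties as ℚ
open import Data.Rational.Solver using (module +-*-Solver)
open import Data.Rational.Unnormalised.Base as ℚᵘ using (mkℚᵘ; *≡*)
import Data.Rational.Unnormalised.Properties as ℚᵘ
import Data.String.Properties as String
open import Data.Sum.Base using (_⊎_; inj₁; inj₂; [_,_]′)
open import Function.Base using (_∘_; id)
open import Function.Bundles using (Equivalence)
open import Relation.Binary.Definitions using (DecidableEquality)
open import Relation.Binary.PropositionalEquality
  using (_≡_; _≢_; refl; sym; trans; cong; cong₂; subst; subst₂)
open import Relation.Nullary.Decidable using (yes; no; does; from-yes; dec-true; dec-false)
open import Relation.Nullary.Negation using (¬_; contradiction)
open import Algebra.Properties.Semiring.Mult (CommutativeRing.semiring ℚ.+-*-commutativeRing) as Mult
  using () renaming (_×_ to _•_)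
open ℚ.≤-Reasoning

-- Rational arithmetic

-- `exec⇓` is a sum over values of limits, and the values returned by the two programs may differ,
-- since they can contain the samplers. Only the total mass is therefore compared, through the
-- monotone rational sequence `term n ρ`, the probability of halting within `n` steps. The loop of
-- `RS` has no bound on its number of iterations, so what `direct` achieves in `n` steps is in
-- general matched by no finite number of steps of `RS`; hence `Approx` allows an arbitrarily small
-- error and as many steps on the right as that error requires. The induction is on the steps of the
-- left program. Each sampler allocates exactly one tape per call, so fresh labels agree on both
-- sides, and the relation only has to tolerate that the tapes left behind have bounds `M` and `N`.
-- The evaluation contexts around the two calls are related rather than equal, because they may hold
-- further copies of the samplers; comparing what follows the calls is thus the induction hypothesis
-- itself.

0≤1 : 0ℚ ≤ 1ℚ
0≤1 = from-yes (0ℚ ℚ.≤? 1ℚ)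

*-monoˡ-≤ : ∀ {r p q} → 0ℚ ≤ r → p ≤ q → r * p ≤ r * q
*-monoˡ-≤ {r} 0≤r = ℚ.*-monoˡ-≤-nonNeg r {{ℚ.nonNegative 0≤r}}

*-pos : ∀ {p q} → 0ℚ ℚ.< p → 0ℚ ℚ.< q → 0ℚ ℚ.< p * q
*-pos {p} {q} 0<p 0<q =
  subst (ℚ._< p * q) (ℚ.*-zeroʳ p) (ℚ.*-monoʳ-<-pos p {{ℚ.positive 0<p}} 0<q)

0≤q-p : ∀ {p q} → p ≤ q → 0ℚ ≤ q - p
0≤q-p {p} {q} p≤q = begin
  0ℚ    ≡⟨ ℚ.+-inverseʳ p ⟨
  p - p ≤⟨ ℚ.+-monoˡ-≤ (- p) p≤q ⟩
  q - p ∎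

0<q-p : ∀ {p q} → p ℚ.< q → 0ℚ ℚ.< q - p
0<q-p {p} {q} p<q = begin-strict
  0ℚ    ≡⟨ ℚ.+-inverseʳ p ⟨
  p - p <⟨ ℚ.+-monoˡ-< (- p) p<q ⟩
  q - p ∎

p≤p+q : ∀ {p q} → 0ℚ ≤ q → p ≤ p + q
p≤p+q {p} {q} 0≤q = begin
  p        ≡⟨ ℚ.+-identityʳ p ⟨
  p + 0ℚ   ≤⟨ ℚ.+-monoʳ-≤ p 0≤q ⟩
  p + q    ∎

fromℚᵘ-homo-+ : ∀ p q → fromℚᵘ p + fromℚᵘ q ≡ fromℚᵘ (p ℚᵘ.+ q)
fromℚᵘ-homo-+ p q = ℚ.toℚᵘ-injective (≃-trans
  (ℚ.toℚᵘ-homo-+ (fromℚᵘ p) (fromℚᵘ q)) (≃-trans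
  (ℚᵘ.+-cong (ℚ.toℚᵘ-fromℚᵘ p) (ℚ.toℚᵘ-fromℚᵘ q))
  (ℚᵘ.≃-sym (ℚ.toℚᵘ-fromℚᵘ (p ℚᵘ.+ q)))))
  where ≃-trans = ℚᵘ.≃-trans

-- A fraction with a variable denominator is normalised by a gcd and does not compute; over
-- unnormalised fractions the multiple is found by clearing denominators.
•-fromℚᵘ : ∀ n i d → n • fromℚᵘ (mkℚᵘ i d) ≡ fromℚᵘ (mkℚᵘ (ℤ.+ n ℤ.* i) d)
•-fromℚᵘ zero    i d = sym (ℚ.fromℚᵘ-cong {mkℚᵘ (ℤ.+ 0 ℤ.* i) d} {ℚᵘ.0ℚᵘ}
  (*≡* (cong (ℤ._* ℤ.+ 1) (ℤ.*-zeroˡ i))))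
•-fromℚᵘ (suc n) i d = trans (cong (fromℚᵘ (mkℚᵘ i d) +_) (•-fromℚᵘ n i d)) (trans
  (fromℚᵘ-homo-+ (mkℚᵘ i d) (mkℚᵘ (ℤ.+ n ℤ.* i) d))
  (ℚ.fromℚᵘ-cong {mkℚᵘ i d ℚᵘ.+ mkℚᵘ (ℤ.+ n ℤ.* i) d} {mkℚᵘ (ℤ.+ suc n ℤ.* i) d} (*≡* (solve 3 (λ i d n →
    (i :* d :+ n :* i :* d) :* d := ((con (ℤ.+ 1) :+ n) :* i) :* (d :* d)) refl i (ℤ.+ suc d) (ℤ.+ n)))))
  where open ℤ.+-*-Solver

1/suc : ℕ → ℚ
1/suc n = ℤ.+ 1 ℚ./ suc n

0<1/suc : ∀ n → 0ℚ ℚ.< 1/suc n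
0<1/suc n = ℚ.positive⁻¹ (1/suc n) {{ℚ.normalize-pos 1 (suc n)}}

suc•1/suc : ∀ n → suc n • 1/suc n ≡ 1ℚ
suc•1/suc n = trans (•-fromℚᵘ (suc n) (ℤ.+ 1) n)
  (ℚ.fromℚᵘ-cong {mkℚᵘ (ℤ.+ suc n ℤ.* ℤ.+ 1) n} {ℚᵘ.1ℚᵘ}
    (*≡* (trans (ℤ.*-identityʳ _)
      (trans (ℤ.*-identityʳ (ℤ.+ suc n)) (sym (ℤ.*-identityˡ (ℤ.+ suc n)))))))

•-monoʳ-≤ : ∀ n {p q} → p ≤ q → n • p ≤ n • q
•-monoʳ-≤ zero    p≤q = ℚ.≤-refl
•-monoʳ-≤ (suc n) p≤q = ℚ.+-mono-≤ p≤q (•-monoʳ-≤ n p≤q)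

•-nonneg : ∀ n {p} → 0ℚ ≤ p → 0ℚ ≤ n • p
•-nonneg zero    0≤p = ℚ.≤-refl
•-nonneg (suc n) 0≤p = ℚ.+-mono-≤ 0≤p (•-nonneg n 0≤p)

•-monoˡ-≤ : ∀ {m n p} → 0ℚ ≤ p → m ℕ.≤ n → m • p ≤ n • p
•-monoˡ-≤ {n = n} 0≤p ℕ.z≤n         = •-nonneg n 0≤p
•-monoˡ-≤ {p = p} 0≤p (ℕ.s≤s m≤n) = ℚ.+-monoʳ-≤ p (•-monoˡ-≤ 0≤p m≤n)

-- The numerator of a positive fraction is at least 1, so as many copies as its denominator suffice.
-- This bounds the number of loop iterations.
archimedean : ∀ {p} → 0ℚ ℚ.< p → ∃[ n ] 1ℚ ≤ n • p
archimedean {p} 0<p with ℚ.positive 0<p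
archimedean {ℚ.mkℚ (ℤ.+ suc k) d c} 0<p | _ = suc d , (begin
  1ℚ                                   ≡⟨ suc•1/suc d ⟨
  suc d • 1/suc d                      ≤⟨ •-monoʳ-≤ (suc d) 1/d≤p ⟩
  suc d • ℚ.mkℚ (ℤ.+ suc k) d c          ∎)
  where
  1/d≤p : 1/suc d ≤ ℚ.mkℚ (ℤ.+ suc k) d c
  1/d≤p = ℚ.toℚᵘ-cancel-≤ (ℚᵘ.≤-respˡ-≃ (ℚᵘ.≃-sym (ℚ.toℚᵘ-fromℚᵘ (mkℚᵘ (ℤ.+ 1) d)))
    (ℚᵘ.*≤* (ℤ.*-monoʳ-≤-nonNeg (ℤ.+ suc d) {ℤ.+ 1} {ℤ.+ suc k} (ℤ.+≤+ (ℕ.s≤s ℕ.z≤n)))))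

-- Of `suc n` equal parts only `n` are spent; the part left over makes the inequality strict, also
-- for `n` = 0.
split-gap : ∀ n {p} → 0ℚ ℚ.< p → ∃[ δ ] 0ℚ ℚ.< δ × n • δ ℚ.< p
split-gap n {p} 0<p = p * u , *-pos 0<p (0<1/suc n) , (begin-strict
  n • (p * u)          ≡⟨ ℚ.+-identityˡ _ ⟨
  0ℚ + n • (p * u)     <⟨ ℚ.+-monoˡ-< _ (*-pos 0<p (0<1/suc n)) ⟩
  suc n • (p * u)      ≡⟨ Mult.×-comm-* (suc n) p u ⟨
  p * (suc n • u)      ≡⟨ cong (p *_) (suc•1/suc n) ⟩
  p * 1ℚ               ≡⟨ ℚ.*-identityʳ p ⟩
  p                    ∎)
  where u = 1/suc n

+-swap : ∀ p q r s → p + q + (r + s) ≡ p + r + (q + s)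
+-swap = solve 4 (λ p q r s → p :+ q :+ (r :+ s) := p :+ r :+ (q :+ s)) refl
  where open +-*-Solver

-- Finite sums and expectations

module _ {A : Set} where

  sum-cong : ∀ {f g : A → ℚ} → (∀ a → f a ≡ g a) → ∀ as → sumℚ (map f as) ≡ sumℚ (map g as)
  sum-cong f≡g []       = refl
  sum-cong f≡g (a ∷ as) = cong₂ _+_ (f≡g a) (sum-cong f≡g as)

  sum-mono : ∀ {f g : A → ℚ} {as} → All (λ a → f a ≤ g a) as → sumℚ (map f as) ≤ sumℚ (map g as)
  sum-mono []       = ℚ.≤-refl
  sum-mono (p ∷ ps) = ℚ.+-mono-≤ p (sum-mono ps)

  sum-0 : ∀ (as : List A) → sumℚ (map (λ _ → 0ℚ) as) ≡ 0ℚ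
  sum-0 []       = refl
  sum-0 (a ∷ as) = trans (ℚ.+-identityˡ _) (sum-0 as)

  sum-+ : ∀ (f g : A → ℚ) as →
          sumℚ (map (λ a → f a + g a) as) ≡ sumℚ (map f as) + sumℚ (map g as)
  sum-+ f g []       = refl
  sum-+ f g (a ∷ as) = trans (cong (f a + g a +_) (sum-+ f g as))
    (+-swap (f a) (g a) (sumℚ (map f as)) (sumℚ (map g as)))

  sum-* : ∀ p (f : A → ℚ) as → sumℚ (map (λ a → p * f a) as) ≡ p * sumℚ (map f as)
  sum-* p f []       = sym (ℚ.*-zeroʳ p)
  sum-* p f (a ∷ as) = trans (cong (p * f a +_) (sum-* p f as)) (sym (ℚ.*-distribˡ-+ p _ _))

module _ {A : Set} where

  expect-cong : ∀ (μ : Dist A) {f g : A → ℚ} → (∀ a → f a ≡ g a) → expect μ f ≡ expect μ g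
  expect-cong μ f≡g = sum-cong (λ (p , a) → cong (p *_) (f≡g a)) μ

  expect-dret : ∀ (a : A) f → expect (dret a) f ≡ f a
  expect-dret a f = trans (ℚ.+-identityʳ _) (ℚ.*-identityˡ _)

  expect-dmap : ∀ {B : Set} (h : A → B) μ f → expect (dmap h μ) f ≡ expect μ (f ∘ h)
  expect-dmap h []            f = refl
  expect-dmap h ((p , a) ∷ μ) f = cong (p * f (h a) +_) (expect-dmap h μ f)

  expect-sum : ∀ {B : Set} (μ : Dist A) (f : B → A → ℚ) bs →
               sumℚ (map (λ b → expect μ (f b)) bs) ≡ expect μ (λ a → sumℚ (map (λ b → f b a) bs))
  expect-sum []            f bs = sum-0 bs
  expect-sum ((p , a) ∷ μ) f bs = trans (sum-+ _ _ bs)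
    (cong₂ _+_ (sum-* p (λ b → f b a) bs) (expect-sum μ f bs))

-- Averages over {0, …, N}

-- Indexed by naturals rather than by `Fin`, so that samples with bounds `M` and `N` share one index
-- type and a range can be cut at `suc M`.
∑< : ℕ → (ℕ → ℚ) → ℚ
∑< zero    f = 0ℚ
∑< (suc n) f = f 0 + ∑< n (f ∘ suc)

∑<-cong : ∀ n {f g} → (∀ i → i < n → f i ≡ g i) → ∑< n f ≡ ∑< n g
∑<-cong zero    f≡g = refl
∑<-cong (suc n) f≡g = cong₂ _+_ (f≡g 0 ℕ.z<s) (∑<-cong n (λ i i<n → f≡g (suc i) (ℕ.s<s i<n)))

∑<-mono : ∀ n {f g} → (∀ i → i < n → f i ≤ g i) → ∑< n f ≤ ∑< n g
∑<-mono zero    f≤g = ℚ.≤-refl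
∑<-mono (suc n) f≤g =
  ℚ.+-mono-≤ (f≤g 0 ℕ.z<s) (∑<-mono n (λ i i<n → f≤g (suc i) (ℕ.s<s i<n)))

∑<-const : ∀ n p → ∑< n (λ _ → p) ≡ n • p
∑<-const zero    p = refl
∑<-const (suc n) p = cong (p +_) (∑<-const n p)

∑<-+ : ∀ n f g → ∑< n (λ i → f i + g i) ≡ ∑< n f + ∑< n g
∑<-+ zero    f g = refl
∑<-+ (suc n) f g = trans (cong (f 0 + g 0 +_) (∑<-+ n (f ∘ suc) (g ∘ suc)))
    (+-swap (f 0) (g 0) (∑< n (f ∘ suc)) (∑< n (g ∘ suc)))

∑<-split : ∀ m k f → ∑< (m ℕ.+ k) f ≡ ∑< m f + ∑< k (f ∘ (m ℕ.+_))
∑<-split zero    k f = sym (ℚ.+-identityˡ _)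
∑<-split (suc m) k f =
  trans (cong (f 0 +_) (∑<-split m k (f ∘ suc))) (sym (ℚ.+-assoc (f 0) _ _))

mean : ℕ → (ℕ → ℚ) → ℚ
mean N f = 1/suc N * ∑< (suc N) f

mean-mono : ∀ N {f g} → (∀ i → i ℕ.≤ N → f i ≤ g i) → mean N f ≤ mean N g
mean-mono N f≤g =
  *-monoˡ-≤ (ℚ.<⇒≤ (0<1/suc N)) (∑<-mono (suc N) (λ i i<n → f≤g i (ℕ.s≤s⁻¹ i<n)))

mean-cong : ∀ N {f g} → (∀ i → f i ≡ g i) → mean N f ≡ mean N g
mean-cong N f≡g = cong (1/suc N *_) (∑<-cong (suc N) (λ i _ → f≡g i))

mean-const : ∀ N p → mean N (λ _ → p) ≡ p
mean-const N p = begin-equality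
  u * ∑< (suc N) (λ _ → p)   ≡⟨ cong (u *_) (∑<-const (suc N) p) ⟩
  u * (suc N • p)            ≡⟨ Mult.×-comm-* (suc N) u p ⟩
  suc N • (u * p)            ≡⟨ Mult.×-assoc-* (suc N) u p ⟨
  (suc N • u) * p            ≡⟨ cong (_* p) (suc•1/suc N) ⟩
  1ℚ * p                     ≡⟨ ℚ.*-identityˡ p ⟩
  p                          ∎
  where u = 1/suc N

mean-+ : ∀ N f p → mean N (λ i → f i + p) ≡ mean N f + p
mean-+ N f p = begin-equality
  u * ∑< (suc N) (λ i → f i + p)       ≡⟨ cong (u *_) (∑<-+ (suc N) f (λ _ → p)) ⟩
  u * (∑< (suc N) f + ∑< (suc N) (λ _ → p)) ≡⟨ ℚ.*-distribˡ-+ u _ _ ⟩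
  mean N f + mean N (λ _ → p)          ≡⟨ cong (mean N f +_) (mean-const N p) ⟩
  mean N f + p                         ∎
  where u = 1/suc N

mean-nonneg : ∀ N {f} → (∀ i → 0ℚ ≤ f i) → 0ℚ ≤ mean N f
mean-nonneg N {f} 0≤f = subst (_≤ mean N f) (mean-const N 0ℚ) (mean-mono N (λ i _ → 0≤f i))

expect-dunif : ∀ N f → expect (dunif N) (f ∘ toℕ) ≡ mean N f
expect-dunif N f = trans (go (suc N) (id)) (cong (u *_) (∑<-tabulate (suc N) f))
  where

  u = 1/suc N
  go : ∀ n (h : Fin n → Fin (suc N)) →
       expect (map (λ i → u , i) (tabulate h)) (f ∘ toℕ) ≡ u * sumℚ (tabulate (f ∘ toℕ ∘ h))
  go zero    h = sym (ℚ.*-zeroʳ u)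
  go (suc n) h = trans (cong (u * f (toℕ (h Fin.zero)) +_) (go n (h ∘ Fin.suc)))
    (sym (ℚ.*-distribˡ-+ u (f (toℕ (h Fin.zero))) (sumℚ (tabulate (f ∘ toℕ ∘ h ∘ Fin.suc)))))
  ∑<-tabulate : ∀ n f → sumℚ (tabulate {n = n} (f ∘ toℕ)) ≡ ∑< n f
  ∑<-tabulate zero    f = refl
  ∑<-tabulate (suc n) f = cong (f 0 +_) (∑<-tabulate n (f ∘ suc))

-- Conditioning on acceptance: the first `suc M` of the `suc N` equally likely outcomes have total
-- weight `w`, and an accepted outcome is uniform on {0, ..., M}.
mean-reject : ∀ {M N} → M < N → ∀ {f h} a →
              (∀ i → i ℕ.≤ M → h i ≡ f i) → (∀ i → M < i → h i ≡ a) →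
              let w = suc M • 1/suc N in
              mean N h ≡ w * mean M f + (1ℚ - w) * a
mean-reject {M} {N} M<N {f} {h} a acc rej = begin-equality
  u * ∑< (suc N) h
    ≡⟨ cong (λ n → u * ∑< n h) N≡ ⟨
  u * ∑< (suc M ℕ.+ k) h
    ≡⟨ cong (u *_) (∑<-split (suc M) k h) ⟩
  u * (∑< (suc M) h + ∑< k (h ∘ (suc M ℕ.+_)))
    ≡⟨ cong₂ (λ x y → u * (x + y))
         (∑<-cong (suc M) (λ i i<n → acc i (ℕ.s≤s⁻¹ i<n)))
         (trans (∑<-cong k (λ i _ → rej (suc M ℕ.+ i) (ℕ.m≤m+n (suc M) i))) (∑<-const k a)) ⟩
  u * (∑< (suc M) f + k • a)
    ≡⟨ ℚ.*-distribˡ-+ u _ _ ⟩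
  u * ∑< (suc M) f + u * (k • a)
    ≡⟨ cong₂ _+_ accept reject ⟩
  w * mean M f + (1ℚ - w) * a ∎
  where
  u = 1/suc N
  w = suc M • u
  k = N ℕ.∸ M
  N≡ : suc M ℕ.+ k ≡ suc N
  N≡ = cong suc (ℕ.m+[n∸m]≡n (ℕ.<⇒≤ M<N))
  accept : u * ∑< (suc M) f ≡ w * mean M f
  accept = begin-equality
    u * S                                ≡⟨ ℚ.*-identityˡ _ ⟨
    -- Writing 1 as `suc M` copies of `1/suc M` produces the weight that `mean M` carries.
    1ℚ * (u * S)                         ≡⟨ cong (_* (u * S)) (suc•1/suc M) ⟨
    (suc M • 1/suc M) * (u * S)          ≡⟨ Mult.×-assoc-* (suc M) (1/suc M) (u * S) ⟩
    suc M • (1/suc M * (u * S))          ≡⟨ cong (suc M •_) (solve 3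
      (λ x y z → x :* (y :* z) := y :* (x :* z)) refl (1/suc M) u S) ⟩
    suc M • (u * mean M f)               ≡⟨ Mult.×-assoc-* (suc M) u (mean M f) ⟨
    w * mean M f                         ∎
    where
    open +-*-Solver
    S = ∑< (suc M) f
  k•u≡ : k • u ≡ 1ℚ - w
  k•u≡ = begin-equality
    k • u                ≡⟨ solve 2 (λ x y → y := x :+ y :- x) refl w (k • u) ⟩
    w + k • u - w        ≡⟨ cong (_- w) (Mult.×-homo-+ u (suc M) k) ⟨
    (suc M ℕ.+ k) • u - w ≡⟨ cong (λ n → n • u - w) N≡ ⟩
    suc N • u - w        ≡⟨ cong (_- w) (suc•1/suc N) ⟩
    1ℚ - w               ∎
    where open +-*-Solver
  reject : u * (k • a) ≡ (1ℚ - w) * a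
  reject = begin-equality
    u * (k • a)   ≡⟨ Mult.×-comm-* k u a ⟩
    k • (u * a)   ≡⟨ Mult.×-assoc-* k u a ⟨
    (k • u) * a   ≡⟨ cong (_* a) k•u≡ ⟩
    (1ℚ - w) * a  ∎

-- Replacing closed thunks

-- Closedness takes the form of invariance under substitution, which is what `~-substᵉ` uses at
-- `thunk`. The bodies are parameters, so that both directions of the equivalence are instances.
module Replace
  (b b′ : Expr)
  (b-closed  : ∀ x v → substᵉ x v b ≡ b)
  (b′-closed : ∀ x v → substᵉ x v b′ ≡ b′)
  where

  infix 4 _~_ _~ˢ_ _~ᶜ_ _~ᵀ_ _~ᴰ_ _~ᶠ_
  -- A copy of the first thunk may also be related to itself, by `rec`: the context can contain its
  -- own copies of a sampler, and these are left alone.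
  data _~_ : Expr → Expr → Set where
    thunk  : lam nothing b ~ lam nothing b′
    lit    : ∀ l → lit l ~ lit l
    var    : ∀ x → var x ~ var x
    rec    : ∀ f x {e e′} → e ~ e′ → rec f x e ~ rec f x e′
    Λ      : ∀ {e e′} → e ~ e′ → Λ e ~ Λ e′
    op₁    : ∀ o {e e′} → e ~ e′ → op₁ o e ~ op₁ o e′
    op₂    : ∀ o {d d′ e e′} → d ~ d′ → e ~ e′ → op₂ o d e ~ op₂ o d′ e′
    ite    : ∀ {c c′ d d′ e e′} → c ~ c′ → d ~ d′ → e ~ e′ → ite c d e ~ ite c′ d′ e′
    case   : ∀ {c c′} x {d d′} y {e e′} → c ~ c′ → d ~ d′ → e ~ e′ →
             case c x d y e ~ case c′ x d′ y e′
    unpack : ∀ {d d′} x {e e′} → d ~ d′ → e ~ e′ → unpack d x e ~ unpack d′ x e′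

  ~-refl : ∀ e → e ~ e
  ~-refl (lit l)          = lit l
  ~-refl (var x)          = var x
  ~-refl (rec f x e)      = rec f x (~-refl e)
  ~-refl (Λ e)            = Λ (~-refl e)
  ~-refl (op₁ o e)        = op₁ o (~-refl e)
  ~-refl (op₂ o d e)      = op₂ o (~-refl d) (~-refl e)
  ~-refl (ite c d e)      = ite (~-refl c) (~-refl d) (~-refl e)
  ~-refl (case c x d y e) = case x y (~-refl c) (~-refl d) (~-refl e)
  ~-refl (unpack d x e)   = unpack x (~-refl d) (~-refl e)

  ~-ctx : ∀ C → C ⟦ lam nothing b ⟧ ~ C ⟦ lam nothing b′ ⟧
  ~-ctx hole                = thunk
  ~-ctx (recC f x C)        = rec f x (~-ctx C)
  ~-ctx (ΛC C)              = Λ (~-ctx C)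
  ~-ctx (op₁C o C)          = op₁ o (~-ctx C)
  ~-ctx (op₂Cˡ o C e)       = op₂ o (~-ctx C) (~-refl e)
  ~-ctx (op₂Cʳ o e C)       = op₂ o (~-refl e) (~-ctx C)
  ~-ctx (iteC₁ C d e)       = ite (~-ctx C) (~-refl d) (~-refl e)
  ~-ctx (iteC₂ c C e)       = ite (~-refl c) (~-ctx C) (~-refl e)
  ~-ctx (iteC₃ c d C)       = ite (~-refl c) (~-refl d) (~-ctx C)
  ~-ctx (caseC₁ C x d y e)  = case x y (~-ctx C) (~-refl d) (~-refl e)
  ~-ctx (caseC₂ c x C y e)  = case x y (~-refl c) (~-ctx C) (~-refl e)
  ~-ctx (caseC₃ c x d y C)  = case x y (~-refl c) (~-refl d) (~-ctx C)
  ~-ctx (unpackC₁ C x e)    = unpack x (~-ctx C) (~-refl e)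
  ~-ctx (unpackC₂ d x C)    = unpack x (~-refl d) (~-ctx C)

  ~-isVal : ∀ {e e′} → e ~ e′ → isVal e ≡ isVal e′
  ~-isVal thunk            = refl
  ~-isVal (lit l)          = refl
  ~-isVal (var x)          = refl
  ~-isVal (rec f x _)      = refl
  ~-isVal (Λ _)            = refl
  ~-isVal (op₁ inl r)      = ~-isVal r
  ~-isVal (op₁ inr r)      = ~-isVal r
  ~-isVal (op₁ pack r)     = ~-isVal r
  ~-isVal (op₁ fold r)     = ~-isVal r
  ~-isVal (op₁ fst _)      = refl
  ~-isVal (op₁ snd _)      = refl
  ~-isVal (op₁ ref _)      = refl
  ~-isVal (op₁ load _)     = refl
  ~-isVal (op₁ rand _)     = refl
  ~-isVal (op₁ tape _)     = refl
  ~-isVal (op₁ tapp _)     = refl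
  ~-isVal (op₁ unfold _)   = refl
  ~-isVal (op₂ pair r s)   rewrite ~-isVal r | ~-isVal s = refl
  ~-isVal (op₂ app _ _)    = refl
  ~-isVal (op₂ store _ _)  = refl
  ~-isVal (op₂ randₜ _ _)  = refl
  ~-isVal (op₂ (bin _) _ _) = refl
  ~-isVal (ite _ _ _)      = refl
  ~-isVal (case _ _ _ _ _) = refl
  ~-isVal (unpack _ _ _)   = refl

  val≁nonval : ∀ {A : Set} {e e′} → e ~ e′ → T (isVal e) → ¬ T (isVal e′) → A
  val≁nonval r v ¬v = contradiction (subst T (~-isVal r) v) ¬v

  nonval≁val : ∀ {A : Set} {e e′} → e ~ e′ → ¬ T (isVal e) → T (isVal e′) → A
  nonval≁val r ¬v v = contradiction (subst T (sym (~-isVal r)) v) ¬v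

  -- The bound of an empty tape cannot be observed, as reading from an empty
  -- tape samples afresh, and no program can fill it.
  data _~ᵀ_ : Tape → Tape → Set where
    same  : ∀ {t} → t ~ᵀ t
    empty : ∀ {N N′} → (N , []) ~ᵀ (N′ , [])

  record _~ˢ_ (σ σ′ : State) : Set where
    constructor ⟨_,_⟩
    field
      heap~  : Pointwise (λ (k , e , _) (k′ , e′ , _) → k ≡ k′ × e ~ e′) (heap σ) (heap σ′)
      tapes~ : Pointwise (λ (k , t) (k′ , t′) → k ≡ k′ × t ~ᵀ t′) (tapes σ) (tapes σ′)
  open _~ˢ_

  _~ᶜ_ : Cfg → Cfg → Set
  (e , σ) ~ᶜ (e′ , σ′) = e ~ e′ × σ ~ˢ σ′

  -- Outcomes are coupled pairwise, a uniform sample with the same sample. Only `force` leaves the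
  -- relation: a thunk has been called, and the bodies themselves remain to be compared.
  data _~ᴰ_ : Dist Cfg → Dist Cfg → Set where
    ret : ∀ {c c′} → c ~ᶜ c′ → dret c ~ᴰ dret c′
    stuck : dzero ~ᴰ dzero
    unif : ∀ N {σ σ′} → σ ~ˢ σ′ → uniform N σ ~ᴰ uniform N σ′
    force : ∀ {σ σ′} → σ ~ˢ σ′ → dret (b , σ) ~ᴰ dret (b′ , σ′)

  ~ˢ-refl : ∀ σ → σ ~ˢ σ
  ~ˢ-refl σ = ⟨ Pointwise.refl (refl , ~-refl _) , Pointwise.refl (refl , same) ⟩

  -- Freshness depends on the keys alone, so related states allocate the same locations and labels,
  -- and no renaming enters the relation.
  fresh-cong : ∀ {A : Set} {R : A → A → Set} {m m′ : List (ℕ × A)} →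
               Pointwise (λ (k , a) (k′ , a′) → k ≡ k′ × R a a′) m m′ → fresh m ≡ fresh m′
  fresh-cong []                = refl
  fresh-cong ((refl , _) ∷ rs) = cong (_ ⊔_) (fresh-cong rs)

  lookup-cong : ∀ {A : Set} {R : A → A → Set} {m m′ : List (ℕ × A)} k →
                Pointwise (λ (k , a) (k′ , a′) → k ≡ k′ × R a a′) m m′ →
                Maybe.Pointwise R (lookup ℕ._≟_ k m) (lookup ℕ._≟_ k m′)
  lookup-cong k [] = nothing
  lookup-cong k (_∷_ {x = k′ , _} (refl , r) rs) with does (k ℕ.≟ k′)
  ... | true  = just r
  ... | false = lookup-cong k rs

  ~-substᵉ : ∀ x {v v′ e e′} → v ~ v′ → e ~ e′ → substᵉ x v e ~ substᵉ x v′ e′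

  ~-if : ∀ c {d d′ e e′} → d ~ d′ → e ~ e′ →
         (if c then d else e) ~ (if c then d′ else e′)
  ~-if true  d e = d
  ~-if false d e = e

  ~-substᵉ x {v} {v′} r thunk =
    subst₂ (λ e e′ → lam nothing e ~ lam nothing e′)
           (sym (b-closed x v)) (sym (b′-closed x v′)) thunk
  ~-substᵉ x r (lit l)          = lit l
  ~-substᵉ x r (var y)          = ~-if (does (x String.≟ y)) r (var y)
  ~-substᵉ x r (rec f y e)      = rec f y (~-if (binds f x ∨ binds y x) e (~-substᵉ x r e))
  ~-substᵉ x r (Λ e)            = Λ (~-substᵉ x r e)
  ~-substᵉ x r (op₁ o e)        = op₁ o (~-substᵉ x r e)
  ~-substᵉ x r (op₂ o d e)      = op₂ o (~-substᵉ x r d) (~-substᵉ x r e)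
  ~-substᵉ x r (ite c d e)      = ite (~-substᵉ x r c) (~-substᵉ x r d) (~-substᵉ x r e)
  ~-substᵉ x r (case y z c d e) =
    case y z (~-substᵉ x r c) (~-if (binds y x) d (~-substᵉ x r d))
                              (~-if (binds z x) e (~-substᵉ x r e))
  ~-substᵉ x r (unpack y d e)   =
    unpack y (~-substᵉ x r d) (~-if (binds y x) e (~-substᵉ x r e))

  ~-substᴮ : ∀ x {v v′ e e′} → v ~ v′ → e ~ e′ → substᴮ x v e ~ substᴮ x v′ e′
  ~-substᴮ nothing  r s = s
  ~-substᴮ (just x) r s = ~-substᵉ x r s

  ref-~ : ∀ {e e′ σ σ′} → e ~ e′ → σ ~ˢ σ′ →
          headStep (op₁ ref e) σ ~ᴰ headStep (op₁ ref e′) σ′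
  ref-~ {e} {e′} r s with val? e | val? e′
  ... | yes _ | yes _ rewrite fresh-cong (heap~ s) =
    ret (lit _ , ⟨ (refl , r) ∷ heap~ s , tapes~ s ⟩)
  ... | no _  | no _  = stuck
  ... | yes v | no ¬v = val≁nonval r v ¬v
  ... | no ¬v | yes v = nonval≁val r ¬v v

  load-~ : ∀ ℓ {σ σ′} → σ ~ˢ σ′ →
           headStep (op₁ load (lit (loc ℓ))) σ ~ᴰ headStep (op₁ load (lit (loc ℓ))) σ′
  load-~ ℓ {σ} {σ′} s
    with lookup ℕ._≟_ ℓ (heap σ) | lookup ℕ._≟_ ℓ (heap σ′) | lookup-cong ℓ (heap~ s)
  ... | just _  | just _  | just r  = ret (r , s)
  ... | nothing | nothing | nothing = stuck

  store-~ : ∀ ℓ {e e′ σ σ′} → e ~ e′ → σ ~ˢ σ′ →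
            headStep (op₂ store (lit (loc ℓ)) e) σ ~ᴰ headStep (op₂ store (lit (loc ℓ)) e′) σ′
  store-~ ℓ {e} {e′} {σ} {σ′} r s
    with lookup ℕ._≟_ ℓ (heap σ) | lookup ℕ._≟_ ℓ (heap σ′) | lookup-cong ℓ (heap~ s)
       | val? e | val? e′
  ... | just _  | just _  | just _  | yes _ | yes _ =
    ret (lit _ , ⟨ (refl , r) ∷ heap~ s , tapes~ s ⟩)
  ... | just _  | just _  | just _  | no _  | no _  = stuck
  ... | just _  | just _  | just _  | yes v | no ¬v = val≁nonval r v ¬v
  ... | just _  | just _  | just _  | no ¬v | yes v = nonval≁val r ¬v v
  ... | nothing | nothing | nothing | _     | _     = stuck

  -- Operators act on literals, and `~` relates a literal only to itself; so no equality test can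
  -- tell the two thunks apart.
  bin-~ : ∀ o l l′ {σ σ′} → σ ~ˢ σ′ →
          headStep (op₂ (bin o) (lit l) (lit l′)) σ ~ᴰ headStep (op₂ (bin o) (lit l) (lit l′)) σ′
  bin-~ o l l′ s with evalBin o l l′
  ... | just l″ = ret (lit l″ , s)
  ... | nothing = stuck

  tape-~ : ∀ z {σ σ′} → σ ~ˢ σ′ →
           headStep (op₁ tape (lit (int z))) σ ~ᴰ headStep (op₁ tape (lit (int z))) σ′
  tape-~ z s rewrite fresh-cong (tapes~ s) =
    ret (lit _ , ⟨ heap~ s , (refl , same) ∷ tapes~ s ⟩)

  -- A tape with contents stems from the initial state and is the same on both sides; tapes whose
  -- bounds differ are empty, and then both reads sample afresh with the bound `N` of the read.
  randTape-~ : ∀ N ι {t t′ σ σ′} → t ~ᵀ t′ → σ ~ˢ σ′ → randTape N ι t σ ~ᴰ randTape N ι t′ σ′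
  randTape-~ N ι empty                  s = unif N s
  randTape-~ N ι (same {N′ , []})       s = unif N s
  randTape-~ N ι (same {N′ , n ∷ w})    s with does (N′ ℕ.≟ N)
  ... | true  = ret (lit _ , ⟨ heap~ s , (refl , same) ∷ tapes~ s ⟩)
  ... | false = unif N s

  randₜ-~ : ∀ z ι {σ σ′} → σ ~ˢ σ′ →
            headStep (op₂ randₜ (lit (int z)) (lit (lbl ι))) σ ~ᴰ
            headStep (op₂ randₜ (lit (int z)) (lit (lbl ι))) σ′
  randₜ-~ z ι {σ} {σ′} s
    with lookup ℕ._≟_ ι (tapes σ) | lookup ℕ._≟_ ι (tapes σ′) | lookup-cong ι (tapes~ s)
  ... | just _  | just _  | just t  = randTape-~ (toBound z) ι t s
  ... | nothing | nothing | nothing = stuck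

  -- The equation excludes the stuck terms r: there headStep r σ computes to [],
  -- so the coverage checker discards their cases.
  headStep-~ : ∀ {r r′ σ σ′ c μ} → r ~ r′ → σ ~ˢ σ′ → headStep r σ ≡ c ∷ μ →
               headStep r σ ~ᴰ headStep r′ σ′
  headStep-~ (op₂ app thunk _)                       s _ = force s
  headStep-~ (op₂ app (rec f x e) v)                 s _ =
    ret (~-substᴮ f (rec f x e) (~-substᴮ x v e) , s)
  headStep-~ (op₂ (bin o) (lit l) (lit l′))          s _ = bin-~ o l l′ s
  headStep-~ (ite (lit (bool true)) d e)             s _ = ret (d , s)
  headStep-~ (ite (lit (bool false)) d e)            s _ = ret (e , s)
  headStep-~ (op₁ fst (op₂ pair v w))                s _ = ret (v , s)
  headStep-~ (op₁ snd (op₂ pair v w))                s _ = ret (w , s)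
  headStep-~ (case x y (op₁ inl v) d e)              s _ = ret (~-substᴮ x v d , s)
  headStep-~ (case x y (op₁ inr v) d e)              s _ = ret (~-substᴮ y v e , s)
  headStep-~ (op₁ tapp (Λ e))                        s _ = ret (e , s)
  headStep-~ (unpack x (op₁ pack v) e)               s _ = ret (~-substᴮ x v e , s)
  headStep-~ (op₁ unfold (op₁ fold v))               s _ = ret (v , s)
  headStep-~ (op₁ ref e)                             s _ = ref-~ e s
  headStep-~ (op₁ load (lit (loc ℓ)))                s _ = load-~ ℓ s
  headStep-~ (op₂ store (lit (loc ℓ)) e)             s _ = store-~ ℓ e s
  headStep-~ (op₁ rand (lit (int z)))                s _ = unif (toBound z) s
  headStep-~ (op₁ tape (lit (int z)))                s _ = tape-~ z s
  headStep-~ (op₂ randₜ (lit (int z)) (lit (lbl ι))) s _ = randₜ-~ z ι s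

  -- Evaluation contexts of related expressions

  data _~ᶠ_ : Frame → Frame → Set where
    op₁F    : ∀ o → op₁F o ~ᶠ op₁F o
    op₂Fʳ   : ∀ o {e e′} → e ~ e′ → op₂Fʳ o e ~ᶠ op₂Fʳ o e′
    op₂Fˡ   : ∀ o {v v′} → proj₁ v ~ proj₁ v′ → op₂Fˡ o v ~ᶠ op₂Fˡ o v′
    iteF    : ∀ {d d′ e e′} → d ~ d′ → e ~ e′ → iteF d e ~ᶠ iteF d′ e′
    caseF   : ∀ x {d d′} y {e e′} → d ~ d′ → e ~ e′ → caseF x d y e ~ᶠ caseF x d′ y e′
    unpackF : ∀ x {e e′} → e ~ e′ → unpackF x e ~ᶠ unpackF x e′

  fillF-~ : ∀ {F F′ e e′} → F ~ᶠ F′ → e ~ e′ → fillF F e ~ fillF F′ e′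
  fillF-~ (op₁F o)        r = op₁ o r
  fillF-~ (op₂Fʳ o s)     r = op₂ o s r
  fillF-~ (op₂Fˡ o s)     r = op₂ o r s
  fillF-~ (iteF s t)      r = ite r s t
  fillF-~ (caseF x y s t) r = case x y r s t
  fillF-~ (unpackF x s)   r = unpack x r s

  fill-~ : ∀ {K K′ e e′} → Pointwise _~ᶠ_ K K′ → e ~ e′ → fill K e ~ fill K′ e′
  fill-~ []       r = r
  fill-~ (F ∷ K) r = fillF-~ F (fill-~ K r)

  _~ᵈ_ : List Frame × Expr → List Frame × Expr → Set
  (K , r) ~ᵈ (K′ , r′) = Pointwise _~ᶠ_ K K′ × r ~ r′

  -- By `~-isVal` both sides agree on which arguments are values, so the search for the redex
  -- follows the same path.
  decomp-~ : ∀ {e e′} → e ~ e′ → decomp e ~ᵈ decomp e′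

  within-~ : ∀ {F F′ e e′} → F ~ᶠ F′ → e ~ e′ → within F e ~ᵈ within F′ e′
  within-~ F r = let (K , s) = decomp-~ r in F ∷ K , s

  decomp-~ thunk       = [] , thunk
  decomp-~ (lit l)     = [] , lit l
  decomp-~ (var x)     = [] , var x
  decomp-~ (rec f x r) = [] , rec f x r
  decomp-~ (Λ r)       = [] , Λ r
  decomp-~ (op₁ o {e} {e′} r) with val? e | val? e′
  ... | yes _ | yes _ = [] , op₁ o r
  ... | no _  | no _  = within-~ (op₁F o) r
  ... | yes v | no ¬v = val≁nonval r v ¬v
  ... | no ¬v | yes v = nonval≁val r ¬v v
  decomp-~ (op₂ o {d} {d′} {e} {e′} q r) with val? d | val? d′ | val? e | val? e′
  ... | yes _ | yes _ | yes _ | yes _ = [] , op₂ o q r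
  ... | no _  | no _  | yes _ | yes _ = within-~ (op₂Fˡ o r) q
  ... | no _  | no _  | no _  | no _  = within-~ (op₂Fʳ o q) r
  ... | yes _ | yes _ | no _  | no _  = within-~ (op₂Fʳ o q) r
  ... | _     | _     | yes v | no ¬v = val≁nonval r v ¬v
  ... | _     | _     | no ¬v | yes v = nonval≁val r ¬v v
  ... | yes v | no ¬v | _     | _     = val≁nonval q v ¬v
  ... | no ¬v | yes v | _     | _     = nonval≁val q ¬v v
  decomp-~ (ite {c} {c′} r s t) with val? c | val? c′
  ... | yes _ | yes _ = [] , ite r s t
  ... | no _  | no _  = within-~ (iteF s t) r
  ... | yes v | no ¬v = val≁nonval r v ¬v
  ... | no ¬v | yes v = nonval≁val r ¬v v
  decomp-~ (case {c} {c′} x y r s t) with val? c | val? c′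
  ... | yes _ | yes _ = [] , case x y r s t
  ... | no _  | no _  = within-~ (caseF x y s t) r
  ... | yes v | no ¬v = val≁nonval r v ¬v
  ... | no ¬v | yes v = nonval≁val r ¬v v
  decomp-~ (unpack {d} {d′} x r s) with val? d | val? d′
  ... | yes _ | yes _ = [] , unpack x r s
  ... | no _  | no _  = within-~ (unpackF x s) r
  ... | yes v | no ¬v = val≁nonval r v ¬v
  ... | no ¬v | yes v = nonval≁val r ¬v v

-- Evaluation contexts

¬T⇒≡false : ∀ {b} → ¬ T b → b ≡ false
¬T⇒≡false {false} _  = refl
¬T⇒≡false {true}  ¬t = contradiction _ ¬t

isVal-fillF : ∀ F {e} → isVal e ≡ false → isVal (fillF F e) ≡ false
isVal-fillF (op₁F fst)          e∉ = refl
isVal-fillF (op₁F snd)          e∉ = refl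
isVal-fillF (op₁F inl)          e∉ = e∉
isVal-fillF (op₁F inr)          e∉ = e∉
isVal-fillF (op₁F ref)          e∉ = refl
isVal-fillF (op₁F load)         e∉ = refl
isVal-fillF (op₁F rand)         e∉ = refl
isVal-fillF (op₁F tape)         e∉ = refl
isVal-fillF (op₁F tapp)         e∉ = refl
isVal-fillF (op₁F pack)         e∉ = e∉
isVal-fillF (op₁F fold)         e∉ = e∉
isVal-fillF (op₁F unfold)       e∉ = refl
isVal-fillF (op₂Fʳ app d)       e∉ = refl
isVal-fillF (op₂Fʳ pair d)      e∉ = trans (cong (isVal d ∧_) e∉) (∧-zeroʳ (isVal d))
isVal-fillF (op₂Fʳ store d)     e∉ = refl
isVal-fillF (op₂Fʳ randₜ d)     e∉ = refl
isVal-fillF (op₂Fʳ (bin o) d)   e∉ = refl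
isVal-fillF (op₂Fˡ app v)       e∉ = refl
isVal-fillF (op₂Fˡ pair v)      e∉ = cong (_∧ isVal (proj₁ v)) e∉
isVal-fillF (op₂Fˡ store v)     e∉ = refl
isVal-fillF (op₂Fˡ randₜ v)     e∉ = refl
isVal-fillF (op₂Fˡ (bin o) v)   e∉ = refl
isVal-fillF (iteF _ _)          e∉ = refl
isVal-fillF (caseF _ _ _ _)     e∉ = refl
isVal-fillF (unpackF _ _)       e∉ = refl

isVal-fill : ∀ K {e} → isVal e ≡ false → isVal (fill K e) ≡ false
isVal-fill []      e∉ = e∉
isVal-fill (F ∷ K) {e} e∉ = isVal-fillF F {fill K e} (isVal-fill K {e} e∉)

decomp-fillF : ∀ F {e} → isVal e ≡ false → decomp (fillF F e) ≡ within F e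
decomp-fillF F {e} e∉ with val? e in eq
decomp-fillF F                 e∉ | yes v = contradiction (subst T e∉ v) id
decomp-fillF (op₁F o)          e∉ | no _ rewrite eq = refl
decomp-fillF (op₂Fʳ o d)       e∉ | no _ rewrite eq = refl
decomp-fillF (op₂Fˡ o (d , v)) {e} e∉ | no _ rewrite eq with val? d
-- The frame stores one proof that `d` is a value and `decomp` finds another; `T` is a proposition,
-- so the frames agree.
... | yes v′ = cong (λ v → within (op₂Fˡ o (d , v)) e) (T-irrelevant v′ v)
... | no ¬v  = contradiction v ¬v
decomp-fillF (iteF _ _)        e∉ | no _ rewrite eq = refl
decomp-fillF (caseF _ _ _ _)   e∉ | no _ rewrite eq = refl
decomp-fillF (unpackF _ _)     e∉ | no _ rewrite eq = refl

-- Makes it possible to execute a sampler inside an unknown evaluation context `K`.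
decomp-fill : ∀ K {e} → isVal e ≡ false →
              decomp (fill K e) ≡ (K ++ proj₁ (decomp e) , proj₂ (decomp e))
decomp-fill []      e∉ = refl
decomp-fill (F ∷ K) {e} e∉ = trans (decomp-fillF F {fill K e} (isVal-fill K {e} e∉))
  (cong (λ (K , r) → F ∷ K , r) (decomp-fill K {e} e∉))

fill-++ : ∀ K K′ e → fill (K ++ K′) e ≡ fill K (fill K′ e)
fill-++ []      K′ e = refl
fill-++ (F ∷ K) K′ e = cong (fillF F) (fill-++ K K′ e)

-- Subdistributions

Nonneg : {A : Set} → Dist A → Set
Nonneg = All (λ (p , _) → 0ℚ ≤ p)

expect-mono : ∀ {A : Set} {μ : Dist A} {f g} → Nonneg μ → (∀ a → f a ≤ g a) →
              expect μ f ≤ expect μ g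
expect-mono nn f≤g = sum-mono (All.map (λ {(p , a)} 0≤p → *-monoˡ-≤ 0≤p (f≤g a)) nn)

expect-0 : ∀ {A : Set} (μ : Dist A) → expect μ (λ _ → 0ℚ) ≡ 0ℚ
expect-0 μ = trans (sum-cong (λ (p , _) → ℚ.*-zeroʳ p) μ) (sum-0 μ)

expect-uniform : ∀ N σ f → expect (uniform N σ) f ≡ mean N (λ i → f (natLit i , σ))
expect-uniform N σ f = trans
  (expect-dmap (λ n → natLit (toℕ n) , σ) (dunif N) f)
  (expect-dunif N (λ i → f (natLit i , σ)))

Subdist : {A : Set} → Dist A → Set
Subdist μ = Nonneg μ × expect μ (λ _ → 1ℚ) ≤ 1ℚ

dmap-subdist : ∀ {A B : Set} (f : A → B) {μ} → Subdist μ → Subdist (dmap f μ)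
dmap-subdist f {μ} (nn , ≤1) =
  All.map⁺ (All.map id nn) , subst (_≤ 1ℚ) (sym (expect-dmap f μ (λ _ → 1ℚ))) ≤1

dret-subdist : ∀ {A : Set} (a : A) → Subdist (dret a)
dret-subdist a = 0≤1 ∷ [] , ℚ.≤-reflexive (expect-dret a (λ _ → 1ℚ))

uniform-subdist : ∀ N σ → Subdist (uniform N σ)
uniform-subdist N σ =
  All.map⁺ (All.map⁺ (All.universal (λ _ → ℚ.<⇒≤ (0<1/suc N)) _)) ,
  ℚ.≤-reflexive (trans (expect-uniform N σ (λ _ → 1ℚ)) (mean-const N 1ℚ))

headStep-subdist : ∀ r σ → Subdist (headStep r σ)
headStep-subdist r σ with headStep r σ in eq
... | []    = [] , 0≤1
... | _ ∷ _ = subst Subdist eq (subdist (headStep-~ (~-refl r) (~ˢ-refl σ) eq))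
  where
  -- r is related to itself; this serves only to find the shape of headStep r σ.
  open Replace (lit unit) (lit unit) (λ _ _ → refl) (λ _ _ → refl)
  subdist : ∀ {μ μ′} → μ ~ᴰ μ′ → Subdist μ
  subdist (ret _)    = dret-subdist _
  subdist stuck      = [] , 0≤1
  subdist (unif N _) = uniform-subdist N _
  subdist (force _)  = dret-subdist _

step-subdist : ∀ ρ → Subdist (step ρ)
step-subdist (e , σ) = dmap-subdist _ (headStep-subdist (proj₂ (decomp e)) σ)

-- Execution for finitely many steps

-- The expected payoff when stopping at `e` pays `φ e`. Indicators give `execₙ`, `halted` gives the
-- termination probability, and sums of indicators connect the two.
run : (Expr → ℚ) → ℕ → Cfg → ℚ
run φ zero    (e , σ) = φ e
run φ (suc n) (e , σ) = if isVal e then φ e else expect (step (e , σ)) (run φ n)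

halted : Expr → ℚ
halted e = if isVal e then 1ℚ else 0ℚ

term : ℕ → Cfg → ℚ
term = run halted

execₙ-run : ∀ n ρ v → execₙ n ρ v ≡ run (λ e → indicator e v) n ρ
execₙ-run zero    (e , σ) v = refl
execₙ-run (suc n) (e , σ) v with isVal e
... | true  = refl
... | false = expect-cong (step (e , σ)) (λ ρ → execₙ-run n ρ v)

run-value : ∀ φ n e σ → isVal e ≡ true → run φ n (e , σ) ≡ φ e
run-value φ zero    e σ e∈ = refl
run-value φ (suc n) e σ e∈ rewrite e∈ = refl

run-step : ∀ φ n e σ → isVal e ≡ false → run φ (suc n) (e , σ) ≡ expect (step (e , σ)) (run φ n)
run-step φ n e σ e∉ rewrite e∉ = refl

run-mono-φ : ∀ {φ ψ} n ρ → (∀ e → φ e ≤ ψ e) → run φ n ρ ≤ run ψ n ρ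
run-mono-φ zero    (e , σ) φ≤ψ = φ≤ψ e
run-mono-φ (suc n) (e , σ) φ≤ψ with isVal e
... | true  = φ≤ψ e
... | false = expect-mono (proj₁ (step-subdist (e , σ))) (λ ρ → run-mono-φ n ρ φ≤ψ)

run-nonneg : ∀ {φ} n ρ → (∀ e → 0ℚ ≤ φ e) → 0ℚ ≤ run φ n ρ
run-nonneg zero    (e , σ) 0≤φ = 0≤φ e
run-nonneg (suc n) (e , σ) 0≤φ with isVal e
... | true  = 0≤φ e
... | false = subst (_≤ expect (step (e , σ)) _) (expect-0 (step (e , σ)))
  (expect-mono (proj₁ (step-subdist (e , σ))) (λ ρ → run-nonneg n ρ 0≤φ))

-- A computation that runs out of steps before a value has earned nothing, so a further step can
-- only gain.
run-mono-suc : ∀ {φ} n ρ → (∀ e → 0ℚ ≤ φ e) → (∀ e → isVal e ≡ false → φ e ≡ 0ℚ) →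
               run φ n ρ ≤ run φ (suc n) ρ
run-mono-suc {φ} zero (e , σ) 0≤φ φ≡0 with isVal e in e∈?
... | true  = ℚ.≤-refl
... | false rewrite φ≡0 e e∈? = subst (_≤ expect (step (e , σ)) _) (expect-0 (step (e , σ)))
  (expect-mono (proj₁ (step-subdist (e , σ))) (λ ρ → run-nonneg zero ρ 0≤φ))
run-mono-suc (suc n) (e , σ) 0≤φ φ≡0 with isVal e
... | true  = ℚ.≤-refl
... | false = expect-mono (proj₁ (step-subdist (e , σ))) (λ ρ → run-mono-suc n ρ 0≤φ φ≡0)

run-mono : ∀ {φ m n} ρ → (∀ e → 0ℚ ≤ φ e) → (∀ e → isVal e ≡ false → φ e ≡ 0ℚ) →
           m ℕ.≤ n → run φ m ρ ≤ run φ n ρ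
run-mono {φ} {m} {n} ρ 0≤φ φ≡0 m≤n =
  subst (λ n → run φ m ρ ≤ run φ n ρ) (ℕ.m∸n+n≡m m≤n) (go (n ℕ.∸ m))
  where
  go : ∀ k → run φ m ρ ≤ run φ (k ℕ.+ m) ρ
  go zero    = ℚ.≤-refl
  go (suc k) = ℚ.≤-trans (go k) (run-mono-suc (k ℕ.+ m) ρ 0≤φ φ≡0)

0≤halted : ∀ e → 0ℚ ≤ halted e
0≤halted e with isVal e
... | true  = 0≤1
... | false = ℚ.≤-refl

halted≡0 : ∀ e → isVal e ≡ false → halted e ≡ 0ℚ
halted≡0 e e∉ rewrite e∉ = refl

term-mono : ∀ {m n} ρ → m ℕ.≤ n → term m ρ ≤ term n ρ
term-mono ρ = run-mono ρ 0≤halted halted≡0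

term-nonneg : ∀ n ρ → 0ℚ ≤ term n ρ
term-nonneg n ρ = run-nonneg n ρ 0≤halted

term-value : ∀ n e σ → isVal e ≡ true → term n (e , σ) ≡ 1ℚ
term-value n e σ e∈ = trans (run-value halted n e σ e∈) (cong (if_then 1ℚ else 0ℚ) e∈)

term≤1 : ∀ n ρ → term n ρ ≤ 1ℚ
term≤1 zero    (e , σ) with isVal e
... | true  = ℚ.≤-refl
... | false = 0≤1
term≤1 (suc n) (e , σ) with isVal e
... | true  = ℚ.≤-refl
... | false = let (nn , ≤1) = step-subdist (e , σ) in
  ℚ.≤-trans (expect-mono nn (term≤1 n)) ≤1

termIn : ℕ → List Frame → Cfg → ℚ
termIn n K (e , σ) = term n (fill K e , σ)

term-decomp : ∀ n {e K r} σ → isVal e ≡ false → decomp e ≡ (K , r) →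
              term (suc n) (e , σ) ≡ expect (headStep r σ) (termIn n K)
term-decomp n {e} σ e∉ refl = trans (run-step halted n e σ e∉)
  (expect-dmap _ (headStep (proj₂ (decomp e)) σ) (term n))

term-fill : ∀ K n {e K′ r} σ → isVal e ≡ false → decomp e ≡ (K′ , r) →
            term (suc n) (fill K e , σ) ≡ expect (headStep r σ) (termIn n (K ++ K′))
term-fill K n {e} {K′} {r} σ e∉ refl =
  term-decomp n {fill K e} σ (isVal-fill K {e} e∉) (decomp-fill K {e} e∉)

-- One step of symbolic execution: for a concrete `e` the premises hold by computation, although `K`
-- stays abstract.
term-dret : ∀ K n {e K′ r e′ σ′} σ → isVal e ≡ false → decomp e ≡ (K′ , r) →
            headStep r σ ≡ dret (e′ , σ′) →
            term (suc n) (fill K e , σ) ≡ term n (fill K (fill K′ e′) , σ′)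
term-dret K n {e} {K′} {r} {e′} {σ′} σ e∉ dec hs = begin-equality
  term (suc n) (fill K e , σ)                   ≡⟨ term-fill K n {e} σ e∉ dec ⟩
  expect (headStep r σ) (termIn n (K ++ K′))    ≡⟨ cong (λ μ → expect μ (termIn n (K ++ K′))) hs ⟩
  expect (dret (e′ , σ′)) (termIn n (K ++ K′))  ≡⟨ expect-dret (e′ , σ′) (termIn n (K ++ K′)) ⟩
  term n (fill (K ++ K′) e′ , σ′)               ≡⟨ cong (λ e → term n (e , σ′)) (fill-++ K K′ e′) ⟩
  term n (fill K (fill K′ e′) , σ′)             ∎

term-uniform : ∀ K n {e K′ r N} σ → isVal e ≡ false → decomp e ≡ (K′ , r) →
               headStep r σ ≡ uniform N σ →
               term (suc n) (fill K e , σ) ≡ mean N (λ i → term n (fill K (fill K′ (natLit i)) , σ))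
term-uniform K n {e} {K′} {r} {N} σ e∉ dec hs = begin-equality
  term (suc n) (fill K e , σ)                   ≡⟨ term-fill K n {e} σ e∉ dec ⟩
  expect (headStep r σ) (termIn n (K ++ K′))    ≡⟨ cong (λ μ → expect μ (termIn n (K ++ K′))) hs ⟩
  expect (uniform N σ) (termIn n (K ++ K′))     ≡⟨ expect-uniform N σ (termIn n (K ++ K′)) ⟩
  mean N (λ i → term n (fill (K ++ K′) (natLit i) , σ))
    ≡⟨ mean-cong N (λ i → cong (λ e → term n (e , σ)) (fill-++ K K′ (natLit i))) ⟩
  mean N (λ i → term n (fill K (fill K′ (natLit i)) , σ)) ∎

-- The termination probability is the limit of term

_≟ⱽ_ : DecidableEquality Val
(e , p) ≟ⱽ (e′ , p′) with e ≟ᴱ e′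
... | yes refl = yes (cong (e ,_) (T-irrelevant p p′))
... | no e≢e′  = no (e≢e′ ∘ cong proj₁)

indicator-self : ∀ v → indicator (proj₁ v) v ≡ 1ℚ
indicator-self (e , _) rewrite dec-true (e ≟ᴱ e) refl = refl

indicator-≢ : ∀ {e} v → e ≢ proj₁ v → indicator e v ≡ 0ℚ
indicator-≢ {e} (e′ , _) e≢ rewrite dec-false (e ≟ᴱ e′) e≢ = refl

0≤indicator : ∀ v e → 0ℚ ≤ indicator e v
0≤indicator (e′ , _) e with does (e ≟ᴱ e′)
... | true  = 0≤1
... | false = ℚ.≤-refl

indicator≡0 : ∀ v e → isVal e ≡ false → indicator e v ≡ 0ℚ
indicator≡0 v e e∉ = indicator-≢ {e} v λ { refl → subst T e∉ (proj₂ v) }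

∑indicator : Expr → List Val → ℚ
∑indicator e = sumℚ ∘ map (indicator e)

∑indicator-∉ : ∀ {e vs} → All (λ v → e ≢ proj₁ v) vs → ∑indicator e vs ≡ 0ℚ
∑indicator-∉ []                   = refl
∑indicator-∉ {e} (_∷_ {x = v} {vs} e≢ e∉) = cong₂ _+_ (indicator-≢ {e} v e≢) (∑indicator-∉ {e} {vs} e∉)

-- Elements of `Val` carry an irrelevant proof, so distinct ones have distinct expressions, and `e`
-- equals at most one of them.
∑indicator≤halted : ∀ {vs} e → Unique vs → ∑indicator e vs ≤ halted e
∑indicator≤halted e [] = 0≤halted e
∑indicator≤halted {(e′ , v) ∷ vs} e (v∉ ∷ u) with e ≟ᴱ e′
... | yes refl = ℚ.≤-reflexive (begin-equality
  1ℚ + ∑indicator e vs ≡⟨ cong (1ℚ +_) (∑indicator-∉ {e} {vs} e∉) ⟩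
  1ℚ + 0ℚ              ≡⟨ ℚ.+-identityʳ 1ℚ ⟩
  1ℚ                   ≡⟨ cong (if_then 1ℚ else 0ℚ) (Equivalence.to T-≡ v) ⟨
  halted e             ∎)
  where
  e∉ : All (λ v → e ≢ proj₁ v) vs
  e∉ = All.map (λ {(_ , v′)} v≢ → λ { refl → v≢ (cong (e ,_) (T-irrelevant v v′)) }) v∉
... | no _     = begin
  0ℚ + ∑indicator e vs ≡⟨ ℚ.+-identityˡ _ ⟩
  ∑indicator e vs      ≤⟨ ∑indicator≤halted e u ⟩
  halted e             ∎

∑exec : ℕ → Cfg → List Val → ℚ
∑exec n ρ = sumℚ ∘ map (execₙ n ρ)

run-∑ : ∀ {A : Set} (φ : A → Expr → ℚ) as n ρ →
        sumℚ (map (λ a → run (φ a) n ρ) as) ≡ run (λ e → sumℚ (map (λ a → φ a e) as)) n ρ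
run-∑ φ as zero    (e , σ) = refl
run-∑ φ as (suc n) (e , σ) with isVal e
... | true  = refl
... | false = trans (expect-sum (step (e , σ)) (λ a → run (φ a) n) as)
                    (expect-cong (step (e , σ)) (run-∑ φ as n))

∑exec≡run : ∀ n ρ vs → ∑exec n ρ vs ≡ run (λ e → ∑indicator e vs) n ρ
∑exec≡run n ρ vs = trans (sum-cong (execₙ-run n ρ) vs) (run-∑ (λ v e → indicator e v) vs n ρ)

∑exec≤term : ∀ n ρ {vs} → Unique vs → ∑exec n ρ vs ≤ term n ρ
∑exec≤term n ρ {vs} u =
  subst (_≤ term n ρ) (sym (∑exec≡run n ρ vs)) (run-mono-φ n ρ (λ e → ∑indicator≤halted e u))

∑indicator-∈ : ∀ {v vs} → v ∈ vs → 1ℚ ≤ ∑indicator (proj₁ v) vs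
∑indicator-∈ {v} {vs = _ ∷ vs} (here refl) = begin
  1ℚ
    ≤⟨ p≤p+q (0≤∑ vs) ⟩
  1ℚ + ∑indicator (proj₁ v) vs
    ≡⟨ cong (_+ ∑indicator (proj₁ v) vs) (indicator-self v) ⟨
  indicator (proj₁ v) v + ∑indicator (proj₁ v) vs ∎
  where
  0≤∑ : ∀ vs → 0ℚ ≤ ∑indicator (proj₁ v) vs
  0≤∑ []       = ℚ.≤-refl
  0≤∑ (w ∷ vs) = ℚ.+-mono-≤ (0≤indicator w (proj₁ v)) (0≤∑ vs)
∑indicator-∈ {v} {w ∷ vs} (there v∈) =
  ℚ.+-mono-≤ (0≤indicator w (proj₁ v)) (∑indicator-∈ v∈)

-- Step distributions have finite support, so this list is finite; no mass of `term n` lies outside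
-- it, which reduces the sum over all values to a finite one.
values : ℕ → Cfg → List Val
outcomes : ℕ → Dist Cfg → List Val
values n (e , σ) with val? e
values n       (e , σ) | yes v = (e , v) ∷ []
values zero    (e , σ) | no _  = []
values (suc n) (e , σ) | no _  = outcomes n (step (e , σ))
outcomes n []            = []
outcomes n ((_ , ρ) ∷ μ) = values n ρ ++ outcomes n μ

-- Stated for every `vs` that contains the values reached, so that a single list serves all branches
-- of a step.
term≤run : ∀ n ρ vs → (∀ {v} → v ∈ values n ρ → v ∈ vs) →
           term n ρ ≤ run (λ e → ∑indicator e vs) n ρ
expect≤run : ∀ n {μ} vs → Nonneg μ → (∀ {v} → v ∈ outcomes n μ → v ∈ vs) →
             expect μ (term n) ≤ expect μ (run (λ e → ∑indicator e vs) n)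
term≤run n (e , σ) vs ⊆ with val? e
term≤run n (e , σ) vs ⊆ | yes v = begin
  term n (e , σ)
    ≡⟨ term-value n e σ (Equivalence.to T-≡ v) ⟩
  1ℚ
    ≤⟨ ∑indicator-∈ (⊆ (here refl)) ⟩
  ∑indicator e vs
    ≡⟨ run-value (λ e → ∑indicator e vs) n e σ (Equivalence.to T-≡ v) ⟨
  run (λ e → ∑indicator e vs) n (e , σ) ∎
term≤run zero (e , σ) vs ⊆ | no ¬v = ℚ.≤-reflexive (trans
  (halted≡0 e (¬T⇒≡false ¬v))
  (sym (∑indicator-∉ {e} {vs} (All.universal (λ { (_ , v) refl → ¬v v }) vs))))
term≤run (suc n) (e , σ) vs ⊆ | no ¬v = begin
  term (suc n) (e , σ)
    ≡⟨ run-step halted n e σ e∉ ⟩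
  expect (step (e , σ)) (term n)
    ≤⟨ expect≤run n vs (proj₁ (step-subdist (e , σ))) ⊆ ⟩
  expect (step (e , σ)) (run (λ e → ∑indicator e vs) n)
    ≡⟨ run-step (λ e → ∑indicator e vs) n e σ e∉ ⟨
  run (λ e → ∑indicator e vs) (suc n) (e , σ) ∎
  where e∉ = ¬T⇒≡false ¬v
expect≤run n {[]}          vs []         ⊆ = ℚ.≤-refl
expect≤run n {(p , ρ) ∷ μ} vs (0≤p ∷ nn) ⊆ = ℚ.+-mono-≤
  (*-monoˡ-≤ 0≤p (term≤run n ρ vs (⊆ ∘ ∈-++⁺ˡ)))
  (expect≤run n vs nn (⊆ ∘ ∈-++⁺ʳ (values n ρ)))

Eventually : (ℕ → Set) → Set
Eventually P = ∃[ k ] (∀ n → k ℕ.≤ n → P n)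

all-eventually : ∀ {A : Set} {P : A → ℕ → Set} {as} → All (λ a → Eventually (P a)) as →
                 Eventually (λ n → All (λ a → P a n) as)
all-eventually []                = 0 , λ _ _ → []
all-eventually ((k , p) ∷ es) = let (l , ps) = all-eventually es in
  k ⊔ l , λ n k⊔l≤n → p n (ℕ.m⊔n≤o⇒m≤o k l k⊔l≤n) ∷ ps n (ℕ.m⊔n≤o⇒n≤o k l k⊔l≤n)

-- Only finitely many lower bounds `g v` occur, so one number of steps serves them all.
exec⇓⇒term : ∀ ρ q → exec⇓ ρ q → ∃[ n ] q ℚ.< term n ρ
exec⇓⇒term ρ q (vs , u , g , g<exec , q<∑g) = n , (begin-strict
  q                 <⟨ q<∑g ⟩
  sumℚ (map g vs)   ≤⟨ sum-mono (bound n ℕ.≤-refl) ⟩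
  ∑exec n ρ vs      ≤⟨ ∑exec≤term n ρ u ⟩
  term n ρ          ∎)
  where
  eventually : Eventually (λ n → All (λ v → g v ≤ execₙ n ρ v) vs)
  eventually = all-eventually (All.map
    (λ (r , g<r , k , r<exec) → k , λ n k≤n → ℚ.<⇒≤ (ℚ.<-trans g<r (r<exec n k≤n))) g<exec)
  n = proj₁ eventually
  bound = proj₂ eventually

-- `exec` consists of strict lower bounds, so each `execₙ n ρ v` is lowered by `δ`. The gap between
-- `q` and `term n ρ` pays for this once per value.
term⇒exec⇓ : ∀ ρ n q → q ℚ.< term n ρ → exec⇓ ρ q
term⇒exec⇓ ρ n q q<term =
  vs , Unique.deduplicate-! _≟ⱽ_ (values n ρ) , g , All.universal g<exec vs , (begin-strict
  q                                      ≡⟨ solve 2 (λ q d → q := q :+ d :- d) refl q (length vs • δ) ⟩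
  q + length vs • δ - length vs • δ      <⟨ ℚ.+-monoˡ-< (- (length vs • δ)) (ℚ.+-monoʳ-< q nδ<gap) ⟩
  q + (term n ρ - q) - length vs • δ     ≡⟨ solve 3 (λ q t d → q :+ (t :- q) :- d := t :- d) refl
                                              q (term n ρ) (length vs • δ) ⟩
  term n ρ - length vs • δ               ≤⟨ ℚ.+-monoˡ-≤ (- (length vs • δ)) term≤∑ ⟩
  ∑exec n ρ vs - length vs • δ           ≡⟨ ∑-δ vs ⟨
  sumℚ (map g vs)                        ∎)
  where
  open +-*-Solver
  vs : List Val
  vs = deduplicate _≟ⱽ_ (values n ρ)
  gap = split-gap (length vs) (0<q-p q<term)
  δ : ℚ
  δ = proj₁ gap
  0<δ : 0ℚ ℚ.< δ
  0<δ = proj₁ (proj₂ gap)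
  nδ<gap : length vs • δ ℚ.< term n ρ - q
  nδ<gap = proj₂ (proj₂ gap)
  g : Val → ℚ
  g v = execₙ n ρ v - δ
  ∑-δ : ∀ vs → sumℚ (map g vs) ≡ ∑exec n ρ vs - length vs • δ
  ∑-δ []       = refl
  ∑-δ (v ∷ vs) = trans (cong (g v +_) (∑-δ vs))
    (solve 4 (λ x d s t → x :- d :+ (s :- t) := x :+ s :- (d :+ t)) refl
      (execₙ n ρ v) δ (∑exec n ρ vs) (length vs • δ))
  term≤∑ : term n ρ ≤ ∑exec n ρ vs
  term≤∑ = subst (term n ρ ≤_) (sym (∑exec≡run n ρ vs))
    (term≤run n ρ vs (∈-deduplicate⁺ _≟ⱽ_))
  exec-mono : ∀ v m → n ℕ.≤ m → execₙ n ρ v ≤ execₙ m ρ v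
  exec-mono v m n≤m = subst₂ _≤_ (sym (execₙ-run n ρ v)) (sym (execₙ-run m ρ v))
    (run-mono ρ (0≤indicator v) (indicator≡0 v) n≤m)
  g<exec : ∀ v → exec ρ v (g v)
  g<exec v = let (r , g<r , r<exec) = ℚ.<-dense g<exec′ in
    r , g<r , n , λ m n≤m → ℚ.<-≤-trans r<exec (exec-mono v m n≤m)
    where
    g<exec′ : g v ℚ.< execₙ n ρ v
    g<exec′ = begin-strict
      execₙ n ρ v - δ   <⟨ ℚ.+-monoʳ-< (execₙ n ρ v) (ℚ.neg-antimono-< 0<δ) ⟩
      execₙ n ρ v + 0ℚ  ≡⟨ ℚ.+-identityʳ _ ⟩
      execₙ n ρ v       ∎

-- A rational strictly below `term n ρ` leaves a gap, which absorbs a small enough error; so a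
-- comparison up to every positive error yields an exact one.
exec⇓-mono : ∀ ρ ρ′ → (∀ n {ε} → 0ℚ ℚ.< ε → ∃[ m ] term n ρ ≤ term m ρ′ + ε) →
             exec⇓ ρ ≤ᴿ exec⇓ ρ′
exec⇓-mono ρ ρ′ approx q q<ρ =
  let (n , q<t)          = exec⇓⇒term ρ q q<ρ
      (ε , 0<ε , ε<gap)  = ℚ.<-dense (0<q-p q<t)
      (m , t≤)           = approx n 0<ε
  in term⇒exec⇓ ρ′ m q (<-by-gap q (term n ρ) (term m ρ′) ε ε<gap t≤)
  where
  open +-*-Solver
  <-by-gap : ∀ q t t′ ε → ε ℚ.< t - q → t ≤ t′ + ε → q ℚ.< t′
  <-by-gap q t t′ ε ε<gap t≤ = begin-strict
    q                  ≡⟨ solve 2 (λ q ε → q := q :+ ε :- ε) refl q ε ⟩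
    q + ε - ε          <⟨ ℚ.+-monoˡ-< (- ε) (ℚ.+-monoʳ-< q ε<gap) ⟩
    q + (t - q) - ε    ≡⟨ solve 3 (λ q t ε → q :+ (t :- q) :- ε := t :- ε) refl q t ε ⟩
    t - ε              ≤⟨ ℚ.+-monoˡ-≤ (- ε) t≤ ⟩
    t′ + ε - ε         ≡⟨ solve 2 (λ t ε → t :+ ε :- ε := t) refl t′ ε ⟩
    t′                 ∎

-- The simulation

-- The error is quantified inside, so that a part of it can be passed on to the continuation;
-- `Eventually` lets finitely many branches share one number of steps on the right.
Approx : ℕ → Cfg → Cfg → Set
Approx n ρ ρ′ = ∀ {ε} → 0ℚ ℚ.< ε → Eventually (λ m → term n ρ ≤ term m ρ′ + ε)

approx-at : ∀ {n ρ ρ′} m {ε} → term n ρ ≤ term m ρ′ + ε →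
            Eventually (λ m → term n ρ ≤ term m ρ′ + ε)
approx-at {ρ′ = ρ′} m {ε} t≤ = m , λ m′ m≤m′ → ℚ.≤-trans t≤ (ℚ.+-monoˡ-≤ ε (term-mono ρ′ m≤m′))

eventually-suc : ∀ {P} → Eventually (P ∘ suc) → Eventually P
eventually-suc (k , p) = suc k , λ { (suc n) (ℕ.s≤s k≤n) → p n k≤n }

eventually-map : ∀ {P Q : ℕ → Set} → (∀ n → P n → Q n) → Eventually P → Eventually Q
eventually-map f (k , p) = k , λ n k≤n → f n (p n k≤n)

eventually-≤ : ∀ {P : ℕ → ℕ → Set} N → (∀ i → Eventually (P i)) →
               Eventually (λ m → ∀ i → i ℕ.≤ N → P i m)
eventually-≤ zero    ev = eventually-map (λ { m p _ ℕ.z≤n → p }) (ev 0)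
eventually-≤ {P} (suc N) ev =
  let (k , p) = eventually-≤ {P ∘ suc} N (ev ∘ suc)
      (l , q) = ev 0
  in k ⊔ l , λ { m k⊔l≤m zero    _           → q m (ℕ.m⊔n≤o⇒n≤o k l k⊔l≤m)
               ; m k⊔l≤m (suc i) (ℕ.s≤s i≤N) → p m (ℕ.m⊔n≤o⇒m≤o k l k⊔l≤m) i i≤N }

-- Averaging preserves a constant error, so a random choice costs nothing, however many outcomes it
-- has.
eventually-mean : ∀ N {f : ℕ → ℚ} {g : ℕ → ℕ → ℚ} {ε} →
                  (∀ i → Eventually (λ m → f i ≤ g m i + ε)) →
                  Eventually (λ m → mean N f ≤ mean N (g m) + ε)
eventually-mean N {f} {g} {ε} ev = eventually-map
  (λ m f≤g → ℚ.≤-trans (mean-mono N f≤g) (ℚ.≤-reflexive (mean-+ N (g m) ε)))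
  (eventually-≤ N ev)

module Simulation
  (b b′ : Expr)
  (b-closed  : ∀ x v → substᵉ x v b ≡ b)
  (b′-closed : ∀ x v → substᵉ x v b′ ≡ b′)
  where

  open Replace b b′ b-closed b′-closed

  -- The hypothesis for the same n suffices to compare the bodies although they
  -- run for k > 0 steps first, because term n ρ ≤ term (k + n) ρ.
  module _
    (bodies : ∀ n → (∀ {ρ ρ′} → ρ ~ᶜ ρ′ → Approx n ρ ρ′) →
              ∀ {K K′ σ σ′} → Pointwise _~ᶠ_ K K′ → σ ~ˢ σ′ →
              Approx n (fill K b , σ) (fill K′ b′ , σ′))
    where

    approx-headStep : ∀ n → (∀ {ρ ρ′} → ρ ~ᶜ ρ′ → Approx n ρ ρ′) →
      ∀ {K K′ μ μ′ ε} → Pointwise _~ᶠ_ K K′ → μ ~ᴰ μ′ → 0ℚ ℚ.< ε →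
      Eventually (λ m → expect μ (termIn n K) ≤ expect μ′ (termIn m K′) + ε)
    approx-headStep n ih {K} {K′} {ε = ε} ks (ret {c} {c′} (r , s)) 0<ε = eventually-map
      (λ m → subst₂ (λ x y → x ≤ y + ε)
        (sym (expect-dret c (termIn n K))) (sym (expect-dret c′ (termIn m K′))))
      (ih {fill K (proj₁ c) , proj₂ c} {fill K′ (proj₁ c′) , proj₂ c′} (fill-~ ks r , s) 0<ε)
    approx-headStep n ih ks stuck 0<ε = 0 , λ _ _ → p≤p+q (ℚ.<⇒≤ 0<ε)
    approx-headStep n ih {K} {K′} {ε = ε} ks (unif N {σ} {σ′} s) 0<ε = eventually-map
      (λ m → subst₂ (λ x y → x ≤ y + ε)
        (sym (expect-uniform N σ (termIn n K))) (sym (expect-uniform N σ′ (termIn m K′))))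
      (eventually-mean N {λ i → term n (fill K (natLit i) , σ)} {λ m i → term m (fill K′ (natLit i) , σ′)}
        (λ i → ih {fill K (natLit i) , σ} {fill K′ (natLit i) , σ′} (fill-~ ks (lit _) , s) 0<ε))
    approx-headStep n ih {K} {K′} {ε = ε} ks (force {σ} {σ′} s) 0<ε = eventually-map
      (λ m → subst₂ (λ x y → x ≤ y + ε)
        (sym (expect-dret (b , σ) (termIn n K))) (sym (expect-dret (b′ , σ′) (termIn m K′))))
      (bodies n ih ks s 0<ε)

    approx-value : ∀ n {e e′} σ σ′ → e ~ e′ → isVal e ≡ true → Approx n (e , σ) (e′ , σ′)
    approx-value n {e} {e′} σ σ′ r e∈ {ε} 0<ε = approx-at {n} {e , σ} {e′ , σ′} 0 (begin
      term n (e , σ)       ≡⟨ term-value n e σ e∈ ⟩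
      1ℚ                   ≡⟨ term-value 0 e′ σ′ (trans (sym (~-isVal r)) e∈) ⟨
      term 0 (e′ , σ′)     ≤⟨ p≤p+q (ℚ.<⇒≤ 0<ε) ⟩
      term 0 (e′ , σ′) + ε ∎)

    simulation : ∀ n {ρ ρ′} → ρ ~ᶜ ρ′ → Approx n ρ ρ′
    simulation n {e , σ} {e′ , σ′} (r , s) 0<ε with isVal e in e∈?
    ... | true = approx-value n σ σ′ r e∈? 0<ε
    simulation zero {e , σ} {e′ , σ′} (r , s) {ε} 0<ε | false = approx-at {0} {e , σ} {e′ , σ′} 0 (begin
      halted e             ≡⟨ halted≡0 e e∈? ⟩
      0ℚ                   ≤⟨ term-nonneg 0 (e′ , σ′) ⟩
      halted e′            ≤⟨ p≤p+q (ℚ.<⇒≤ 0<ε) ⟩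
      halted e′ + ε        ∎)
    simulation (suc n) {e , σ} {e′ , σ′} (r , s) {ε} 0<ε | false = eventually-suc
      (eventually-map (λ m → subst₂ (λ x y → x ≤ y + ε)
          (sym (term-decomp n {e} σ e∈? refl))
          (sym (term-decomp m {e′} σ′ (trans (sym (~-isVal r)) e∈?) refl)))
        approx-step)
      where
      K = proj₁ (decomp e)
      K′ = proj₁ (decomp e′)
      q = proj₂ (decomp e)
      q′ = proj₂ (decomp e′)
      approx-step : Eventually (λ m →
        expect (headStep q σ) (termIn n K) ≤ expect (headStep q′ σ′) (termIn m K′) + ε)
      approx-step with headStep q σ in h
      -- Without a step the left side has probability 0, and nonnegativity of the right side
      -- suffices.
      ... | [] = 0 , λ m _ → ℚ.≤-trans
        (subst (_≤ expect (headStep q′ σ′) (termIn m K′)) (expect-0 (headStep q′ σ′))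
          (expect-mono (proj₁ (headStep-subdist q′ σ′)) (λ (e , σ) → term-nonneg m (fill K′ e , σ))))
        (p≤p+q (ℚ.<⇒≤ 0<ε))
      ... | c ∷ μ = let (ks , qs) = decomp-~ r in
        approx-headStep n (simulation n) ks
          (subst (_~ᴰ headStep q′ σ′) h (headStep-~ qs s h)) 0<ε

    refines : ∀ Ξ Γ τ → CtxRefines Ξ Γ (lam nothing b) (lam nothing b′) τ
    refines Ξ Γ τ τ′ C _ σ = exec⇓-mono (C ⟦ lam nothing b ⟧ , σ) (C ⟦ lam nothing b′ ⟧ , σ) λ n 0<ε →
      let (m , t≤) = simulation n (~-ctx C , ~ˢ-refl σ) 0<ε in m , t≤ m ℕ.≤-refl

-- The two samplers

directBody : ℕ → Expr
directBody M = let′ (just "ι") (op₁ tape (natLit M)) (op₂ randₜ (natLit M) (var "ι"))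

loop : ℕ → ℕ → Expr → Expr
loop M N t = rec (just "rs") nothing
  (let′ (just "x") (op₂ randₜ (natLit N) t)
    (ite (op₂ (bin le) (var "x") (natLit M)) (var "x") (op₂ app (var "rs") (lit unit))))

RSBody : ℕ → ℕ → Expr
RSBody M N = let′ (just "ι") (op₁ tape (natLit N)) (op₂ app (loop M N (var "ι")) (lit unit))

-- Every variable is bound, so the outcome of the name tests is irrelevant; generalising the tests
-- to booleans lets each case compute.
directBody-closed : ∀ M x v → substᵉ x v (directBody M) ≡ directBody M
directBody-closed M x v = go (does (x String.≟ "ι"))
  where
  read : Expr → Expr
  read t = op₂ randₜ (natLit M) t
  go : ∀ p → let′ (just "ι") (op₁ tape (natLit M))
               (if p then read (var "ι") else read (if p then v else var "ι"))
             ≡ directBody M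
  go true  = refl
  go false = refl

RSBody-closed : ∀ M N x v → substᵉ x v (RSBody M N) ≡ RSBody M N
RSBody-closed M N x v = go (does (x String.≟ "ι")) (does (x String.≟ "rs")) (does (x String.≟ "x"))
  where
  check : Expr → Expr → Expr
  check x rs = ite (op₂ (bin le) x (natLit M)) x (op₂ app rs (lit unit))
  iter : Expr → Expr → Expr
  iter t e = let′ (just "x") (op₂ randₜ (natLit N) t) e
  enter : Expr → Expr
  enter e = op₂ app (rec (just "rs") nothing e) (lit unit)
  e = iter (var "ι") (check (var "x") (var "rs"))
  go : ∀ p q r →
       let′ (just "ι") (op₁ tape (natLit N))
         (if p then enter e else
          enter (if q ∨ false then e else
                 iter (if p then v else var "ι")
                      (if r then check (var "x") (var "rs") else
                       check (if r then v else var "x") (if q then v else var "rs"))))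
       ≡ RSBody M N
  go true  _     _     = refl
  go false true  _     = refl
  go false false true  = refl
  go false false false = refl

lookup-here : ∀ {A : Set} k (a : A) m → lookup ℕ._≟_ k ((k , a) ∷ m) ≡ just a
lookup-here k a m rewrite dec-true (k ℕ.≟ k) refl = refl

EmptyTape : Lbl → State → Set
EmptyTape ι σ = ∃[ N ] lookup ℕ._≟_ ι (tapes σ) ≡ just (N , [])

headStep-randₜ : ∀ N ι σ → EmptyTape ι σ →
                 headStep (op₂ randₜ (natLit N) (lit (lbl ι))) σ ≡ uniform N σ
headStep-randₜ N ι σ (_ , empty) rewrite empty = refl

newTape : ℕ → State → State
newTape N σ = putTape (fresh (tapes σ)) (N , []) σ

newTape-empty : ∀ N σ → EmptyTape (fresh (tapes σ)) (newTape N σ)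
newTape-empty N σ = N , lookup-here (fresh (tapes σ)) (N , []) (tapes σ)

-- The three steps are the allocation, the `let` and the read; the new tape is empty, so the read is
-- a uniform sample.
term-direct : ∀ M n K σ →
  term (3 ℕ.+ n) (fill K (directBody M) , σ) ≡
  mean M (λ i → term n (fill K (natLit i) , newTape M σ))
term-direct M n K σ = begin-equality
  term (3 ℕ.+ n) (fill K (directBody M) , σ)
    ≡⟨ term-dret K (2 ℕ.+ n) {directBody M} σ refl refl refl ⟩
  term (2 ℕ.+ n) (fill K bind , σ₁)
    ≡⟨ term-dret K (1 ℕ.+ n) {bind} σ₁ refl refl refl ⟩
  term (1 ℕ.+ n) (fill K draw , σ₁)
    ≡⟨ term-uniform K n {draw} σ₁ refl refl (headStep-randₜ M ι σ₁ (newTape-empty M σ)) ⟩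
  mean M (λ i → term n (fill K (natLit i) , σ₁)) ∎
  where
  ι = fresh (tapes σ)
  σ₁ = newTape M σ
  bind draw : Expr
  bind = let′ (just "ι") (lit (lbl ι)) (op₂ randₜ (natLit M) (var "ι"))
  draw = op₂ randₜ (natLit M) (lit (lbl ι))

looping : ℕ → ℕ → Lbl → Expr
looping M N ι = op₂ app (loop M N (lit (lbl ι))) (lit unit)

term-RS : ∀ M N n K σ →
  term (2 ℕ.+ n) (fill K (RSBody M N) , σ) ≡
  term n (fill K (looping M N (fresh (tapes σ))) , newTape N σ)
term-RS M N n K σ = begin-equality
  term (2 ℕ.+ n) (fill K (RSBody M N) , σ)
    ≡⟨ term-dret K (1 ℕ.+ n) {RSBody M N} σ refl refl refl ⟩
  term (1 ℕ.+ n) (fill K bind , newTape N σ)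
    ≡⟨ term-dret K n {bind} (newTape N σ) refl refl refl ⟩
  term n (fill K (looping M N (fresh (tapes σ))) , newTape N σ) ∎
  where
  bind : Expr
  bind = let′ (just "ι") (lit (lbl (fresh (tapes σ))))
           (op₂ app (loop M N (var "ι")) (lit unit))

-- The rejection loop

module Loop
  {M N} (M<N : M < N) (K : List Frame) (ι : Lbl) (σ : State) (empty : EmptyTape ι σ)
  where

  accepted : ℕ → ℕ → ℚ
  accepted n i = term n (fill K (natLit i) , σ)

  L : Expr
  L = looping M N ι

  loopTerm : ℕ → ℚ
  loopTerm n = term n (fill K L , σ)

  p : ℚ
  p = suc M • 1/suc N

  afterDraw : ℕ → Expr
  afterDraw i = let′ (just "x") (natLit i)
    (ite (op₂ (bin le) (var "x") (natLit M)) (var "x") L)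

  drawn : ℕ → ℕ → ℚ
  drawn n i = term (3 ℕ.+ n) (fill K (afterDraw i) , σ)

  drawn-if : ∀ n i → drawn n i ≡ (if does (ℤ.+ i ℤ.≤? ℤ.+ M) then accepted n i else loopTerm n)
  drawn-if n i = begin-equality
    term (3 ℕ.+ n) (fill K (afterDraw i) , σ)
      ≡⟨ term-dret K (2 ℕ.+ n) {afterDraw i} σ refl refl refl ⟩
    term (2 ℕ.+ n) (fill K (ite (op₂ (bin le) (natLit i) (natLit M)) (natLit i) L) , σ)
      ≡⟨ term-dret K (1 ℕ.+ n) {ite (op₂ (bin le) (natLit i) (natLit M)) (natLit i) L} σ refl refl refl ⟩
    term (1 ℕ.+ n) (fill K (ite (lit (bool c)) (natLit i) L) , σ)
      ≡⟨ term-dret K n {ite (lit (bool c)) (natLit i) L} σ refl refl refl ⟩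
    term n (fill K (if c then natLit i else L) , σ)
      ≡⟨ if-float c ⟩
    (if c then accepted n i else loopTerm n) ∎
    where
    c = does (ℤ.+ i ℤ.≤? ℤ.+ M)
    if-float : ∀ c → term n (fill K (if c then natLit i else L) , σ) ≡
                     (if c then accepted n i else loopTerm n)
    if-float true  = refl
    if-float false = refl

  drawn-accept : ∀ n i → i ℕ.≤ M → drawn n i ≡ accepted n i
  drawn-accept n i i≤M = trans (drawn-if n i)
    (cong (if_then accepted n i else loopTerm n) (dec-true (ℤ.+ i ℤ.≤? ℤ.+ M) (+≤+ i≤M)))

  drawn-reject : ∀ n i → M < i → drawn n i ≡ loopTerm n
  drawn-reject n i M<i = trans (drawn-if n i)
    (cong (if_then accepted n i else loopTerm n)
      (dec-false (ℤ.+ i ℤ.≤? ℤ.+ M) (ℕ.<⇒≱ M<i ∘ ℤ.drop‿+≤+)))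

  -- The five steps are the call, the draw, the `let`, the comparison and the conditional. Reading
  -- an empty tape leaves the state unchanged, so a rejection returns to exactly the initial
  -- configuration.
  loopTerm-iterate : ∀ n → loopTerm (5 ℕ.+ n) ≡ p * mean M (accepted n) + (1ℚ - p) * loopTerm n
  loopTerm-iterate n = begin-equality
    loopTerm (5 ℕ.+ n)
      ≡⟨ term-dret K (4 ℕ.+ n) {L} σ refl refl refl ⟩
    term (4 ℕ.+ n) (fill K draw , σ)
      ≡⟨ term-uniform K (3 ℕ.+ n) {draw} σ refl refl (headStep-randₜ N ι σ empty) ⟩
    mean N (drawn n)
      ≡⟨ mean-reject M<N (loopTerm n) (drawn-accept n) (drawn-reject n) ⟩
    p * mean M (accepted n) + (1ℚ - p) * loopTerm n ∎
    where
    draw = let′ (just "x") (op₂ randₜ (natLit N) (lit (lbl ι)))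
             (ite (op₂ (bin le) (var "x") (natLit M)) (var "x") L)

  accepted-mono : ∀ {m n} → m ℕ.≤ n → mean M (accepted m) ≤ mean M (accepted n)
  accepted-mono m≤n = mean-mono M (λ i _ → term-mono (fill K (natLit i) , σ) m≤n)

  0<p : 0ℚ ℚ.< p
  0<p = ℚ.<-≤-trans (0<1/suc N) (p≤p+q (•-nonneg M (ℚ.<⇒≤ (0<1/suc N))))

  0≤1-p : 0ℚ ≤ 1ℚ - p
  0≤1-p = 0≤q-p (ℚ.≤-trans
    (•-monoˡ-≤ (ℚ.<⇒≤ (0<1/suc N)) (ℕ.s≤s (ℕ.<⇒≤ M<N))) (ℚ.≤-reflexive (suc•1/suc N)))

  -- A convex combination of quantities at most `A` is at most `A`. The recurrence advances by five
  -- steps and the induction by one; monotonicity makes up for the other four.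
  loopTerm≤mean : ∀ n → loopTerm n ≤ mean M (accepted n)
  loopTerm≤mean zero = ℚ.≤-trans
    (ℚ.≤-reflexive (halted≡0 (fill K L) (isVal-fill K {L} refl)))
    (mean-nonneg M {accepted 0} (λ i → term-nonneg 0 (fill K (natLit i) , σ)))
  loopTerm≤mean (suc n) = begin
    loopTerm (suc n)               ≤⟨ term-mono (fill K L , σ) (ℕ.m≤n+m (suc n) 4) ⟩
    loopTerm (5 ℕ.+ n)             ≡⟨ loopTerm-iterate n ⟩
    p * A + (1ℚ - p) * loopTerm n  ≤⟨ ℚ.+-monoʳ-≤ (p * A) (*-monoˡ-≤ 0≤1-p (loopTerm≤mean n)) ⟩
    p * A + (1ℚ - p) * A           ≡⟨ solve 2 (λ p a → p :* a :+ (con 1ℚ :- p) :* a := a) refl p A ⟩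
    A                              ≤⟨ accepted-mono (ℕ.n≤1+n n) ⟩
    mean M (accepted (suc n))      ∎
    where
    open +-*-Solver
    A = mean M (accepted n)

  -- Counting starts at `m` steps, so at every later stage the average over the continuations is at
  -- least the fixed target `mean M (accepted m)`, and the gain can be measured against that
  -- constant.
  loopTerm-progress : ∀ m {ε} → 0ℚ ℚ.< ε → ∀ j →
    let a = loopTerm (j ℕ.* 5 ℕ.+ m) in
    mean M (accepted m) ≤ a + ε ⊎ j • (p * ε) ≤ a
  loopTerm-progress m 0<ε zero = inj₂ (term-nonneg m (fill K L , σ))
  loopTerm-progress m {ε} 0<ε (suc j) =
    [ inj₁ ∘ keep , (λ j≤a → [ inj₁ ∘ keep , inj₂ ∘ gain j≤a ]′ (ℚ.≤-total s (a + ε))) ]′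
    (loopTerm-progress m 0<ε j)
    where
    open +-*-Solver
    n = j ℕ.* 5 ℕ.+ m
    a = loopTerm n
    s = mean M (accepted m)
    keep : s ≤ a + ε → s ≤ loopTerm (5 ℕ.+ n) + ε
    keep s≤ = ℚ.≤-trans s≤ (ℚ.+-monoˡ-≤ ε (term-mono (fill K L , σ) (ℕ.m≤n+m n 5)))
    gain : j • (p * ε) ≤ a → a + ε ≤ s → p * ε + j • (p * ε) ≤ loopTerm (5 ℕ.+ n)
    gain j≤a a+ε≤s = begin
      p * ε + j • (p * ε)                     ≤⟨ ℚ.+-mono-≤ (*-monoˡ-≤ (ℚ.<⇒≤ 0<p) ε≤s-a) j≤a ⟩
      p * (s - a) + a                         ≡⟨ solve 3
                                                   (λ p s a → p :* (s :- a) :+ a :=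
                                                              p :* s :+ (con 1ℚ :- p) :* a)
                                                   refl p s a ⟩
      p * s + (1ℚ - p) * a                    ≤⟨ ℚ.+-monoˡ-≤ ((1ℚ - p) * a) (*-monoˡ-≤ (ℚ.<⇒≤ 0<p)
                                                   (accepted-mono (ℕ.m≤n+m m (j ℕ.* 5)))) ⟩
      p * mean M (accepted n) + (1ℚ - p) * a  ≡⟨ loopTerm-iterate n ⟨
      loopTerm (5 ℕ.+ n)                      ∎
      where
      ε≤s-a : ε ≤ s - a
      ε≤s-a = begin
        ε           ≡⟨ solve 2 (λ ε a → ε := a :+ ε :- a) refl ε a ⟩
        a + ε - a   ≤⟨ ℚ.+-monoˡ-≤ (- a) a+ε≤s ⟩
        s - a       ∎

  -- With `j` chosen such that `j • (p * ε)` is at least 1, the second alternative of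
  -- `loopTerm-progress` brings `loopTerm n` to 1, which no average of probabilities exceeds.
  mean≤loopTerm : ∀ m {ε} → 0ℚ ℚ.< ε → ∃[ n ] mean M (accepted m) ≤ loopTerm n + ε
  mean≤loopTerm m {ε} 0<ε = n , [ id , reached ]′ (loopTerm-progress m 0<ε j)
    where
    arch = archimedean (*-pos 0<p 0<ε)
    j = proj₁ arch
    n = j ℕ.* 5 ℕ.+ m
    reached : j • (p * ε) ≤ loopTerm n → mean M (accepted m) ≤ loopTerm n + ε
    reached j•pε≤a = begin
      mean M (accepted m)  ≤⟨ mean-mono M (λ i _ → term≤1 m (fill K (natLit i) , σ)) ⟩
      mean M (λ _ → 1ℚ)    ≡⟨ mean-const M 1ℚ ⟩
      1ℚ                   ≤⟨ proj₂ arch ⟩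
      j • (p * ε)          ≤⟨ j•pε≤a ⟩
      loopTerm n           ≤⟨ p≤p+q (ℚ.<⇒≤ 0<ε) ⟩
      loopTerm n + ε       ∎

-- Comparison of the two calls

module _ {M N} (M<N : M < N) where

  module DirectRS = Replace (directBody M) (RSBody M N) (directBody-closed M) (RSBody-closed M N)
  module RSDirect = Replace (RSBody M N) (directBody M) (RSBody-closed M N) (directBody-closed M)

  direct-approx-RS : ∀ n → (∀ {ρ ρ′} → ρ DirectRS.~ᶜ ρ′ → Approx n ρ ρ′) →
                     ∀ {K K′ σ σ′} → Pointwise DirectRS._~ᶠ_ K K′ → σ DirectRS.~ˢ σ′ →
                     Approx n (fill K (directBody M) , σ) (fill K′ (RSBody M N) , σ′)
  direct-approx-RS n ih {K} {K′} {σ} {σ′} ks s {ε} 0<ε =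
    -- The error is shared: `δ` for the continuations, which fixes `m`, and `ε - δ` for truncating
    -- the loop, where `k` depends on `m`.
    let (δ , 0<δ , δ<ε) = ℚ.<-dense 0<ε
        (m , sampled)   = sample-approx 0<δ
        (k , looped)    = mean≤loopTerm m (0<q-p δ<ε)
    in approx-at {n} {fill K (directBody M) , σ} {fill K′ (RSBody M N) , σ′} (2 ℕ.+ k)
         (combine δ m k (sampled m ℕ.≤-refl) looped)
    where
    open DirectRS
    open DirectRS._~ˢ_
    open +-*-Solver
    open Loop M<N K′ (fresh (tapes σ′)) (newTape N σ′) (newTape-empty N σ′)
    sample : ℕ → ℚ
    sample i = term n (fill K (natLit i) , newTape M σ)
    -- The new tapes have the same label and different bounds; this is the case for which `_~ᵀ_` has
    -- the constructor `empty`.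
    newTape-~ : newTape M σ ~ˢ newTape N σ′
    newTape-~ = ⟨ heap~ s , (fresh-cong (tapes~ s) , empty) ∷ tapes~ s ⟩
    sample-approx : ∀ {δ} → 0ℚ ℚ.< δ → Eventually (λ m → mean M sample ≤ mean M (accepted m) + δ)
    sample-approx 0<δ = eventually-mean M {sample} {accepted}
      (λ i → ih {fill K (natLit i) , newTape M σ} {fill K′ (natLit i) , newTape N σ′}
                (fill-~ ks (lit _) , newTape-~) 0<δ)
    combine : ∀ δ m k → mean M sample ≤ mean M (accepted m) + δ →
              mean M (accepted m) ≤ loopTerm k + (ε - δ) →
              term n (fill K (directBody M) , σ) ≤ term (2 ℕ.+ k) (fill K′ (RSBody M N) , σ′) + ε
    combine δ m k sampled looped = begin
      term n (fill K (directBody M) , σ)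
        ≤⟨ term-mono (fill K (directBody M) , σ) (ℕ.m≤n+m n 3) ⟩
      term (3 ℕ.+ n) (fill K (directBody M) , σ)
        ≡⟨ term-direct M n K σ ⟩
      mean M sample
        ≤⟨ sampled ⟩
      mean M (accepted m) + δ
        ≤⟨ ℚ.+-monoˡ-≤ δ looped ⟩
      loopTerm k + (ε - δ) + δ
        ≡⟨ solve 3 (λ a ε δ → a :+ (ε :- δ) :+ δ := a :+ ε) refl (loopTerm k) ε δ ⟩
      loopTerm k + ε
        ≡⟨ cong (_+ ε) (term-RS M N k K′ σ′) ⟨
      term (2 ℕ.+ k) (fill K′ (RSBody M N) , σ′) + ε ∎

  -- A truncated loop is bounded by the average without error, so all of `ε` goes to the
  -- continuations.
  RS-approx-direct : ∀ n → (∀ {ρ ρ′} → ρ RSDirect.~ᶜ ρ′ → Approx n ρ ρ′) →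
                     ∀ {K K′ σ σ′} → Pointwise RSDirect._~ᶠ_ K K′ → σ RSDirect.~ˢ σ′ →
                     Approx n (fill K (RSBody M N) , σ) (fill K′ (directBody M) , σ′)
  RS-approx-direct n ih {K} {K′} {σ} {σ′} ks s {ε} 0<ε =
    let (m , sampled) = sample-approx
    in approx-at {n} {fill K (RSBody M N) , σ} {fill K′ (directBody M) , σ′} (3 ℕ.+ m)
         (combine m (sampled m ℕ.≤-refl))
    where
    open RSDirect
    open RSDirect._~ˢ_
    open Loop M<N K (fresh (tapes σ)) (newTape N σ) (newTape-empty N σ)
    sample : ℕ → ℕ → ℚ
    sample m i = term m (fill K′ (natLit i) , newTape M σ′)
    newTape-~ : newTape N σ ~ˢ newTape M σ′
    newTape-~ = ⟨ heap~ s , (fresh-cong (tapes~ s) , empty) ∷ tapes~ s ⟩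
    sample-approx : Eventually (λ m → mean M (accepted n) ≤ mean M (sample m) + ε)
    sample-approx = eventually-mean M {accepted n} {sample}
      (λ i → ih {fill K (natLit i) , newTape N σ} {fill K′ (natLit i) , newTape M σ′}
                (fill-~ ks (lit _) , newTape-~) 0<ε)
    combine : ∀ m → mean M (accepted n) ≤ mean M (sample m) + ε →
              term n (fill K (RSBody M N) , σ) ≤ term (3 ℕ.+ m) (fill K′ (directBody M) , σ′) + ε
    combine m sampled = begin
      term n (fill K (RSBody M N) , σ)
        ≤⟨ term-mono (fill K (RSBody M N) , σ) (ℕ.m≤n+m n 2) ⟩
      term (2 ℕ.+ n) (fill K (RSBody M N) , σ)
        ≡⟨ term-RS M N n K σ ⟩
      loopTerm n
        ≤⟨ loopTerm≤mean n ⟩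
      mean M (accepted n)
        ≤⟨ sampled ⟩
      mean M (sample m) + ε
        ≡⟨ cong (_+ ε) (term-direct M m K′ σ′) ⟨
      term (3 ℕ.+ m) (fill K′ (directBody M) , σ′) + ε ∎

mainTheorem3 : (M N : ℕ) → M < N →
    CtxEquiv 0 [] (direct M) (RS M N) (unitᵗ ⇒ natᵗ)
mainTheorem3 M N M<N =
  Simulation.refines (directBody M) (RSBody M N) (directBody-closed M) (RSBody-closed M N)
    (direct-approx-RS M<N) 0 [] (unitᵗ ⇒ natᵗ) ,
  Simulation.refines (RSBody M N) (directBody M) (RSBody-closed M N) (directBody-closed M)
    (RS-approx-direct M<N) 0 [] (unitᵗ ⇒ natᵗ)
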